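{- Let $d \in \mathbb{N}$. For every finite, spherical set $A \subset \mathbb{R}^d$ and every real number $r$ with $0 < r < \mathrm{cr}(A)$, there is some $k = k(A,r) \in \mathbb{N}$ such that the following holds: for every $D \in \mathbb{N}$, there is a colouring of the points of $B_D(r)$ with $k$ colours such that no subset $A' \subset B_D(r)$ congruent to $A$ is monochromatic.
   Context: $\mathbb{N}$ denotes the positive integers and $\|\cdot\|$ the Euclidean norm. For $D \in \mathbb{N}$ and $r \ge 0$, $B_D(r) = \{x \in \mathbb{R}^D : \|x\| \le r\}$ is the closed $D$-dimensional ball of radius $r$ centred at the origin. A finite set $A \subset \mathbb{R}^d$ is called spherical if it lies on some sphere in $\mathbb{R}^d$, i.e. if there are $c \in \mathbb{R}^d$ and $\rho \ge 0$ with $\|x-c\| = \rho$ for all $x \in A$. The circumradius $\mathrm{cr}(A)$ of a spherical set $A \subset \mathbb{R}^d$ is the radius of the smallest sphere containing $A$, i.e. the smallest such $\rho$ (containing means that all points of $A$ lie on the sphere itself). Two sets, possibly in Euclidean spaces of different dimensions, are congruent if there is a distance-preserving bijection between them. A set is monochromatic if all of its points have the same colour. -}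

-- The real numbers are constructed as Cauchy sequences of rationals, identified
-- when their difference tends to 0.  Equality of reals is therefore the setoid
-- equality _≈_, and sets of points are considered up to pointwise _≈_.

module Defs where

open import Algebra.Bundles.Raw using (RawMonoid)
import Algebra.Definitions.RawMonoid as RawMonoidDefs
open import Data.Bool.Base using (if_then_else_)
open import Data.Empty using (⊥-elim)
open import Data.Fin.Base using (Fin)
open import Data.Integer.Base as ℤ using (+_; -[1+_])
import Data.Integer.Properties as ℤ
open import Data.List.Base using (List)
import Data.List.Membership.Setoid as Membership
open import Data.Nat.Base as ℕ using (ℕ; zero; suc)
import Data.Nat.Properties as ℕ
open import Data.Product.Base using (Σ; ∃; ∃-syntax; Σ-syntax; _×_; _,_; proj₁; proj₂)
open import Data.Rational.Base as ℚ using (ℚ; mkℚ; 0ℚ; 1ℚ; ½; _/_; ↥_; ↧_)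
import Data.Rational.Properties as ℚ
open import Data.Rational.Solver using (module +-*-Solver)
import Data.Rational.Unnormalised.Base as ℚᵘ
import Data.Rational.Unnormalised.Properties as ℚᵘ
open import Data.Sum.Base as Sum using (_⊎_; inj₁; inj₂; [_,_]′)
open import Data.Vec.Functional using (Vector; map; zipWith)
import Data.Vec.Functional.Relation.Binary.Equality.Setoid as VectorEquality
open import Function.Base using (_$_; _on_)
open import Function.Bundles using (Func; Bijection; _⇔_)
open import Level using (0ℓ)
open import Relation.Binary.Bundles using (Setoid)
import Relation.Binary.Construct.On as On
open import Relation.Binary.PropositionalEquality as ≡
  using (_≡_; refl; sym; trans; cong; cong₂; subst)
open import Relation.Nullary using (¬_; Dec; does; yes; no)
open import Relation.Unary using (Pred; _∈_)

------------------------------------------------------------------------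
-- Auxiliary facts about ℚ

module ℚ-Lemmas where
  ∣_-_∣ : ℚ → ℚ → ℚ
  ∣ p - q ∣ = ℚ.∣ p ℚ.- q ∣

  p≤∣p∣ : ∀ p → p ℚ.≤ ℚ.∣ p ∣
  p≤∣p∣ p with ℚ.≤-total 0ℚ p
  ... | inj₁ 0≤p = ℚ.≤-reflexive (sym (ℚ.0≤p⇒∣p∣≡p 0≤p))
  ... | inj₂ p≤0 = ℚ.≤-trans p≤0 (ℚ.0≤∣p∣ p)

  ∣p-q∣≡∣q-p∣ : ∀ p q → ∣ p - q ∣ ≡ ∣ q - p ∣
  ∣p-q∣≡∣q-p∣ p q = trans (sym (ℚ.∣-p∣≡∣p∣ (p ℚ.- q)))
    (cong ℚ.∣_∣ (solve 2 (λ p q → :- (p :- q) := q :- p) refl p q))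
    where open +-*-Solver

  ∣p-p∣≡0 : ∀ p → ∣ p - p ∣ ≡ 0ℚ
  ∣p-p∣≡0 p = cong ℚ.∣_∣ (ℚ.+-inverseʳ p)

  triangle : ∀ p q r → ∣ p - r ∣ ℚ.≤ ∣ p - q ∣ ℚ.+ ∣ q - r ∣
  triangle p q r = subst (ℚ._≤ ∣ p - q ∣ ℚ.+ ∣ q - r ∣)
    (cong ℚ.∣_∣ (solve 3 (λ p q r → (p :- q) :+ (q :- r) := p :- r) refl p q r))
    (ℚ.∣p+q∣≤∣p∣+∣q∣ (p ℚ.- q) (q ℚ.- r))
    where open +-*-Solver

  ∣p-q∣<ε⇒p<q+ε : ∀ p q {ε} → ∣ p - q ∣ ℚ.< ε → p ℚ.< q ℚ.+ ε
  ∣p-q∣<ε⇒p<q+ε p q {ε} h = subst (ℚ._< q ℚ.+ ε)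
    (solve 2 (λ p q → q :+ (p :- q) := p) refl p q)
    (ℚ.+-monoʳ-< q (ℚ.≤-<-trans (p≤∣p∣ (p ℚ.- q)) h))
    where open +-*-Solver

  ∣p-q∣≤ε : ∀ {p q ε} → p ℚ.≤ q ℚ.+ ε → q ℚ.≤ p ℚ.+ ε → ∣ p - q ∣ ℚ.≤ ε
  ∣p-q∣≤ε {p} {q} {ε} h₁ h₂ with ℚ.∣p∣≡p∨∣p∣≡-p (p ℚ.- q)
  ... | inj₁ eq = subst (ℚ._≤ ε) (sym eq)
    (subst (p ℚ.- q ℚ.≤_) (solve 2 (λ q ε → (q :+ ε) :- q := ε) refl q ε)
      (ℚ.+-monoˡ-≤ (ℚ.- q) h₁))
    where open +-*-Solver
  ... | inj₂ eq = subst (ℚ._≤ ε)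
    (sym (trans eq (solve 2 (λ p q → :- (p :- q) := q :- p) refl p q)))
    (subst (q ℚ.- p ℚ.≤_) (solve 2 (λ p ε → (p :+ ε) :- p := ε) refl p ε)
      (ℚ.+-monoˡ-≤ (ℚ.- p) h₂))
    where open +-*-Solver

  half : ℚ → ℚ
  half ε = ε ℚ.* ½

  half+half : ∀ ε → half ε ℚ.+ half ε ≡ ε
  half+half ε = trans (sym (ℚ.*-distribˡ-+ ε ½ ½)) (ℚ.*-identityʳ ε)

  0<p*q : ∀ {p q} → 0ℚ ℚ.< p → 0ℚ ℚ.< q → 0ℚ ℚ.< p ℚ.* q
  0<p*q {p} {q} 0<p 0<q = subst (ℚ._< p ℚ.* q) (ℚ.*-zeroʳ p)
    (ℚ.*-monoʳ-<-pos p {{ℚ.positive 0<p}} 0<q)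

  0≤p*q : ∀ {p q} → 0ℚ ℚ.≤ p → 0ℚ ℚ.≤ q → 0ℚ ℚ.≤ p ℚ.* q
  0≤p*q {p} {q} 0≤p 0≤q = subst (ℚ._≤ p ℚ.* q) (ℚ.*-zeroʳ p)
    (ℚ.*-monoˡ-≤-nonNeg p {{ℚ.nonNegative 0≤p}} 0≤q)

  *-mono-≤ : ∀ {p q r s} → 0ℚ ℚ.≤ p → 0ℚ ℚ.≤ s →
             p ℚ.≤ q → r ℚ.≤ s → p ℚ.* r ℚ.≤ q ℚ.* s
  *-mono-≤ {p} {q} {r} {s} 0≤p 0≤s p≤q r≤s = ℚ.≤-trans
    (ℚ.*-monoˡ-≤-nonNeg p {{ℚ.nonNegative 0≤p}} r≤s)
    (ℚ.*-monoʳ-≤-nonNeg s {{ℚ.nonNegative 0≤s}} p≤q)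

  0<½ : 0ℚ ℚ.< ½
  0<½ = ℚ.positive⁻¹ ½

  0<half : ∀ {ε} → 0ℚ ℚ.< ε → 0ℚ ℚ.< half ε
  0<half 0<ε = 0<p*q 0<ε 0<½

  half< : ∀ {ε} → 0ℚ ℚ.< ε → half ε ℚ.< ε
  half< {ε} 0<ε = subst (ℚ._< ε) (ℚ.+-identityʳ (half ε))
    (subst (half ε ℚ.+ 0ℚ ℚ.<_) (half+half ε) (ℚ.+-monoʳ-< (half ε) (0<half 0<ε)))

  scale : (ε b : ℚ) → 0ℚ ℚ.< ε → 0ℚ ℚ.< b → ∃[ δ ] 0ℚ ℚ.< δ × b ℚ.* δ ≡ ε
  scale ε b 0<ε 0<b = b⁻¹ ℚ.* ε , 0<p*q 0<b⁻¹ 0<ε , eq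
    where
    instance
      _ = ℚ.positive 0<b
      _ = ℚ.pos⇒nonZero b
    b⁻¹ = ℚ.1/ b
    0<b⁻¹ : 0ℚ ℚ.< b⁻¹
    0<b⁻¹ = ℚ.positive⁻¹ b⁻¹ {{ℚ.1/pos⇒pos b}}
    eq : b ℚ.* (b⁻¹ ℚ.* ε) ≡ ε
    eq = trans (sym (ℚ.*-assoc b b⁻¹ ε))
      (trans (cong (ℚ._* ε) (ℚ.*-inverseʳ b)) (ℚ.*-identityˡ ε))

open ℚ-Lemmas

------------------------------------------------------------------------
-- Real numbers

IsCauchy : (ℕ → ℚ) → Set
IsCauchy s = ∀ ε → 0ℚ ℚ.< ε →
  ∃[ N ] (∀ m n → N ℕ.≤ m → N ℕ.≤ n → ℚ.∣ s m ℚ.- s n ∣ ℚ.< ε)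

record ℝ : Set where
  constructor mkℝ
  field
    seq    : ℕ → ℚ
    cauchy : IsCauchy seq

open ℝ public

infix 4 _≈_ _<_ _≤_

_≈_ : ℝ → ℝ → Set
x ≈ y = ∀ ε → 0ℚ ℚ.< ε →
  ∃[ N ] (∀ n → N ℕ.≤ n → ℚ.∣ seq x n ℚ.- seq y n ∣ ℚ.< ε)

_<_ : ℝ → ℝ → Set
x < y = ∃[ ε ] 0ℚ ℚ.< ε ×
  ∃[ N ] (∀ n → N ℕ.≤ n → seq x n ℚ.+ ε ℚ.≤ seq y n)

_≤_ : ℝ → ℝ → Set
x ≤ y = ¬ (y < x)

≈-setoid : Setoid 0ℓ 0ℓ
≈-setoid = record
  { Carrier       = ℝ
  ; _≈_           = _≈_
  ; isEquivalence = record
    { refl  = λ {x} ε 0<ε → 0 , λ n _ →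
        subst (ℚ._< ε) (sym (∣p-p∣≡0 (seq x n))) 0<ε
    ; sym   = λ {x} {y} x≈y ε 0<ε → let N , h = x≈y ε 0<ε in N , λ n N≤n →
        subst (ℚ._< ε) (∣p-q∣≡∣q-p∣ (seq x n) (seq y n)) (h n N≤n)
    ; trans = λ {x} {y} {z} x≈y y≈z ε 0<ε →
        let M , h = x≈y (half ε) (0<half 0<ε)
            N , k = y≈z (half ε) (0<half 0<ε)
        in M ℕ.⊔ N , λ n M⊔N≤n → ℚ.≤-<-trans
             (triangle (seq x n) (seq y n) (seq z n))
             (subst (_ ℚ.<_) (half+half ε) (ℚ.+-mono-<
               (h n (ℕ.m⊔n≤o⇒m≤o M N M⊔N≤n)) (k n (ℕ.m⊔n≤o⇒n≤o M N M⊔N≤n))))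
    }
  }

0ℝ : ℝ
0ℝ = mkℝ (λ _ → 0ℚ) λ ε 0<ε → 0 , λ _ _ _ _ → 0<ε

infix  8 -_
infixl 7 _*_
infixl 6 _+_ _-_

_+_ : ℝ → ℝ → ℝ
x + y = mkℝ (λ n → seq x n ℚ.+ seq y n) isCauchy
  where
  isCauchy : IsCauchy (λ n → seq x n ℚ.+ seq y n)
  isCauchy ε 0<ε =
    let M , h = cauchy x (half ε) (0<half 0<ε)
        N , k = cauchy y (half ε) (0<half 0<ε)
    in M ℕ.⊔ N , λ m n ≤m ≤n → ℚ.≤-<-trans
         (subst (ℚ._≤ ∣ seq x m - seq x n ∣ ℚ.+ ∣ seq y m - seq y n ∣)
           (cong ℚ.∣_∣ (solve 4 (λ a b c d → (a :- b) :+ (c :- d) := (a :+ c) :- (b :+ d))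
             refl (seq x m) (seq x n) (seq y m) (seq y n)))
           (ℚ.∣p+q∣≤∣p∣+∣q∣ (seq x m ℚ.- seq x n) (seq y m ℚ.- seq y n)))
         (subst (_ ℚ.<_) (half+half ε) (ℚ.+-mono-<
           (h m n (ℕ.m⊔n≤o⇒m≤o M N ≤m) (ℕ.m⊔n≤o⇒m≤o M N ≤n))
           (k m n (ℕ.m⊔n≤o⇒n≤o M N ≤m) (ℕ.m⊔n≤o⇒n≤o M N ≤n))))
    where open +-*-Solver

-_ : ℝ → ℝ
- x = mkℝ (λ n → ℚ.- seq x n) λ ε 0<ε →
  let N , h = cauchy x ε 0<ε in N , λ m n ≤m ≤n → subst (ℚ._< ε)
    (trans (sym (ℚ.∣-p∣≡∣p∣ (seq x m ℚ.- seq x n)))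
           (cong ℚ.∣_∣ (ℚ.neg-distrib-+ (seq x m) (ℚ.- seq x n))))
    (h m n ≤m ≤n)

_-_ : ℝ → ℝ → ℝ
x - y = x + (- y)

module ℝ-Lemmas where
  bounded : (x : ℝ) → ∃[ B ] 0ℚ ℚ.< B × ∃[ N ] (∀ n → N ℕ.≤ n → ℚ.∣ seq x n ∣ ℚ.≤ B)
  bounded x with cauchy x 1ℚ (ℚ.positive⁻¹ 1ℚ)
  ... | N , h = ℚ.∣ a ∣ ℚ.+ 1ℚ
              , ℚ.+-mono-≤-< (ℚ.0≤∣p∣ a) (ℚ.positive⁻¹ 1ℚ)
              , N , λ n N≤n → ℚ.≤-trans
                  (subst (ℚ._≤ ℚ.∣ a ∣ ℚ.+ ∣ seq x n - a ∣)
                    (cong ℚ.∣_∣ (solve 2 (λ a b → a :+ (b :- a) := b) refl a (seq x n)))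
                    (ℚ.∣p+q∣≤∣p∣+∣q∣ a (seq x n ℚ.- a)))
                  (ℚ.+-monoʳ-≤ ℚ.∣ a ∣ (ℚ.<⇒≤ (h n N N≤n ℕ.≤-refl)))
    where
    a = seq x N
    open +-*-Solver

  ∣ab-cd∣≤ : ∀ a b c d → ∣ a ℚ.* b - c ℚ.* d ∣ ℚ.≤
             ℚ.∣ a ∣ ℚ.* ∣ b - d ∣ ℚ.+ ℚ.∣ d ∣ ℚ.* ∣ a - c ∣
  ∣ab-cd∣≤ a b c d = ≡.subst₂ ℚ._≤_
    (cong ℚ.∣_∣ (solve 4 (λ a b c d → a :* (b :- d) :+ d :* (a :- c) := a :* b :- c :* d)
      refl a b c d))
    (cong₂ ℚ._+_ (ℚ.∣p*q∣≡∣p∣*∣q∣ a (b ℚ.- d)) (ℚ.∣p*q∣≡∣p∣*∣q∣ d (a ℚ.- c)))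
    (ℚ.∣p+q∣≤∣p∣+∣q∣ (a ℚ.* (b ℚ.- d)) (d ℚ.* (a ℚ.- c)))
    where open +-*-Solver

open ℝ-Lemmas

_*_ : ℝ → ℝ → ℝ
x * y = mkℝ (λ n → seq x n ℚ.* seq y n) isCauchy
  where
  isCauchy : IsCauchy (λ n → seq x n ℚ.* seq y n)
  isCauchy ε 0<ε =
    let Bx , 0<Bx , M₁ , bx = bounded x
        By , 0<By , M₂ , by = bounded y
        ε′                  = half (half ε)
        0<ε′                = 0<half (0<half 0<ε)
        δ₁ , 0<δ₁ , eq₁     = scale ε′ Bx 0<ε′ 0<Bx
        δ₂ , 0<δ₂ , eq₂     = scale ε′ By 0<ε′ 0<By
        N₁ , h₁             = cauchy y δ₁ 0<δ₁
        N₂ , h₂             = cauchy x δ₂ 0<δ₂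
        M                   = M₁ ℕ.⊔ M₂
        N                   = N₁ ℕ.⊔ N₂
    in M ℕ.⊔ N , λ m n ≤m ≤n →
      let M≤m = ℕ.m⊔n≤o⇒m≤o M N ≤m
          N≤m = ℕ.m⊔n≤o⇒n≤o M N ≤m
          M≤n = ℕ.m⊔n≤o⇒m≤o M N ≤n
          N≤n = ℕ.m⊔n≤o⇒n≤o M N ≤n
          step : ∀ a {B c δ} → 0ℚ ℚ.< δ → B ℚ.* δ ≡ ε′ →
                 ℚ.∣ a ∣ ℚ.≤ B → c ℚ.< δ → ℚ.∣ a ∣ ℚ.* c ℚ.≤ ε′
          step a 0<δ eq a≤B c<δ = subst (_ ℚ.≤_) eq
            (*-mono-≤ (ℚ.0≤∣p∣ a) (ℚ.<⇒≤ 0<δ) a≤B (ℚ.<⇒≤ c<δ))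
      in ℚ.≤-<-trans (∣ab-cd∣≤ (seq x m) (seq y m) (seq x n) (seq y n))
         (ℚ.≤-<-trans
           (subst (_ ℚ.≤_) (half+half (half ε)) (ℚ.+-mono-≤
             (step (seq x m) 0<δ₁ eq₁ (bx m (ℕ.m⊔n≤o⇒m≤o M₁ M₂ M≤m))
               (h₁ m n (ℕ.m⊔n≤o⇒m≤o N₁ N₂ N≤m) (ℕ.m⊔n≤o⇒m≤o N₁ N₂ N≤n)))
             (step (seq y n) 0<δ₂ eq₂ (by n (ℕ.m⊔n≤o⇒n≤o M₁ M₂ M≤n))
               (h₂ m n (ℕ.m⊔n≤o⇒n≤o N₁ N₂ N≤m) (ℕ.m⊔n≤o⇒n≤o N₁ N₂ N≤n)))))
           (half< 0<ε))

------------------------------------------------------------------------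
-- Square roots

sq : ℚ → ℚ
sq p = p ℚ.* p

frac : ℕ → ℕ → ℚ
frac m N = + m / suc N

ι : ℕ → ℚ
ι = frac 1

-- largestRoot q N M is the largest m ≤ M with (m / (N + 1))² ≤ q, or 0 if there
-- is none.
largestRoot : ℚ → ℕ → ℕ → ℕ
largestRoot q N zero    = 0
largestRoot q N (suc m) =
  if does (sq (frac (suc m) N) ℚ.≤? q) then suc m else largestRoot q N m

-- For q ≥ 0, √q rounded down to a multiple of 1 / (N + 1); for q < 0 it is 0.
-- The cut-off in the search is harmless, since q ≤ ∣ ↥ q ∣ ≤ (1 + ∣ ↥ q ∣)².
approx√ : ℚ → ℕ → ℚ
approx√ q N = frac (largestRoot q N (suc ℤ.∣ ↥ q ∣ ℕ.* suc N)) N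

module Root-Lemmas where
  toℚᵘ-frac : ∀ i N → ℚ.toℚᵘ (i / suc N) ℚᵘ.≃ ℚᵘ.mkℚᵘ i N
  toℚᵘ-frac i N = ℚ.toℚᵘ-fromℚᵘ (ℚᵘ.mkℚᵘ i N)

  frac-mono : ∀ {i j M N} → ℚᵘ.mkℚᵘ i M ℚᵘ.≤ ℚᵘ.mkℚᵘ j N → i / suc M ℚ.≤ j / suc N
  frac-mono {i} {j} {M} {N} h = ℚ.toℚᵘ-cancel-≤
    (ℚᵘ.≤-respˡ-≃ (ℚᵘ.≃-sym (toℚᵘ-frac i M)) (ℚᵘ.≤-respʳ-≃ (ℚᵘ.≃-sym (toℚᵘ-frac j N)) h))

  0≤frac : ∀ m N → 0ℚ ℚ.≤ frac m N
  0≤frac m N = ℚ.nonNegative⁻¹ (frac m N) {{ℚ.normalize-nonNeg m (suc N)}}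

  0<ι : ∀ N → 0ℚ ℚ.< ι N
  0<ι N = ℚ.positive⁻¹ (ι N) {{ℚ.normalize-pos 1 (suc N)}}

  frac-suc : ∀ m N → frac (suc m) N ≡ frac m N ℚ.+ ι N
  frac-suc m N = ℚ.toℚᵘ-injective (ℚᵘ.≃-trans (toℚᵘ-frac (+ suc m) N)
    (ℚᵘ.≃-sym (ℚᵘ.≃-trans (ℚ.toℚᵘ-homo-+ (frac m N) (ι N))
      (ℚᵘ.≃-trans (ℚᵘ.+-cong (toℚᵘ-frac (+ m) N) (toℚᵘ-frac (+ 1) N))
        (ℚᵘ.*≡* eq)))))
    where
    d = suc N
    eq : (+ m ℤ.* + d ℤ.+ + 1 ℤ.* + d) ℤ.* + d ≡ + suc m ℤ.* (+ d ℤ.* + d)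
    eq = trans (cong (ℤ._* + d) (sym (ℤ.*-distribʳ-+ (+ d) (+ m) (+ 1))))
      (trans (ℤ.*-assoc (+ m ℤ.+ + 1) (+ d) (+ d))
        (cong (λ k → + k ℤ.* (+ d ℤ.* + d)) (ℕ.+-comm m 1)))

  ι-antitone : ∀ {M N} → M ℕ.≤ N → ι N ℚ.≤ ι M
  ι-antitone {M} {N} M≤N = frac-mono {+ 1} {+ 1} {N} {M}
    (ℚᵘ.*≤* (ℤ.*-monoˡ-≤-nonNeg (+ 1) (ℤ.+≤+ (ℕ.s≤s M≤N))))

  archimedean : ∀ ε → 0ℚ ℚ.< ε → ∃[ N ] (∀ n → N ℕ.≤ n → ι n ℚ.≤ ε)
  archimedean (mkℚ (+ zero)   d c) 0<ε = ⊥-elim (ℚ.<-irrefl refl (ℚ.<-≤-trans 0<ε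
    (ℚ.*≤* (ℤ.≤-reflexive refl))))
  archimedean (mkℚ -[1+ p ] d c) 0<ε = ⊥-elim (ℚ.<-asym 0<ε (ℚ.negative⁻¹ _))
  archimedean ε@(mkℚ (+ suc p) d c) 0<ε = d , λ n d≤n → ℚ.≤-trans (ι-antitone d≤n)
    (subst (ι d ℚ.≤_) (ℚ.↥p/↧p≡p ε) (frac-mono {+ 1} {+ suc p} {d} {d}
      (ℚᵘ.*≤* (ℤ.*-monoʳ-≤-nonNeg (+ suc d) {+ 1} {+ suc p} (ℤ.+≤+ (ℕ.s≤s ℕ.z≤n))))))

  i≤∣i∣ : ∀ i → i ℤ.≤ + ℤ.∣ i ∣
  i≤∣i∣ (+ n)    = ℤ.≤-refl
  i≤∣i∣ -[1+ n ] = ℤ.-≤+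

  q≤∣↥q∣ : ∀ q → q ℚ.≤ frac ℤ.∣ ↥ q ∣ 0
  q≤∣↥q∣ q@(mkℚ i d c) = subst (ℚ._≤ frac ℤ.∣ i ∣ 0) (ℚ.↥p/↧p≡p q)
    (frac-mono {i} {+ ℤ.∣ i ∣} {d} {0} (ℚᵘ.*≤* (ℤ.≤-trans
      (ℤ.*-monoʳ-≤-nonNeg (+ 1) (i≤∣i∣ i))
      (ℤ.*-monoˡ-≤-nonNeg (+ ℤ.∣ i ∣) (ℤ.+≤+ (ℕ.s≤s (ℕ.z≤n {d})))))))

  sq-+ : ∀ p q → (sq p ℚ.+ sq q) ℚ.+ (p ℚ.* q ℚ.+ p ℚ.* q) ≡ sq (p ℚ.+ q)
  sq-+ = solve 2 (λ p q → (p :* p :+ q :* q) :+ (p :* q :+ p :* q) := (p :+ q) :* (p :+ q)) refl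
    where open +-*-Solver

  sq-mono : ∀ {p q} → 0ℚ ℚ.≤ p → p ℚ.≤ q → sq p ℚ.≤ sq q
  sq-mono 0≤p p≤q = *-mono-≤ 0≤p (ℚ.≤-trans 0≤p p≤q) p≤q p≤q

  cutoff : ∀ q N → q ℚ.< sq (frac (suc (suc ℤ.∣ ↥ q ∣ ℕ.* suc N)) N)
  cutoff q N = ℚ.≤-<-trans (q≤∣↥q∣ q) $ ℚ.<-≤-trans a<b $ ℚ.≤-trans b≤b²
    (sq-mono (0≤frac (suc a) 0) b≤)
    where
    a = ℤ.∣ ↥ q ∣
    b = frac (suc a) 0
    a<b : frac a 0 ℚ.< b
    a<b = ≡.subst₂ ℚ._<_ (ℚ.+-identityʳ (frac a 0)) (sym (frac-suc a 0))
      (ℚ.+-monoʳ-< (frac a 0) (0<ι 0))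
    1≤b : 1ℚ ℚ.≤ b
    1≤b = subst (1ℚ ℚ.≤_) (trans (ℚ.+-comm (ι 0) (frac a 0)) (sym (frac-suc a 0)))
      (ℚ.+-monoʳ-≤ 1ℚ (0≤frac a 0))
    b≤b² : b ℚ.≤ sq b
    b≤b² = subst (ℚ._≤ sq b) (ℚ.*-identityʳ b)
      (ℚ.*-monoˡ-≤-nonNeg b {{ℚ.nonNegative (0≤frac (suc a) 0)}} 1≤b)
    b≤ : b ℚ.≤ frac (suc (suc a ℕ.* suc N)) N
    b≤ = frac-mono {+ suc a} {+ suc (suc a ℕ.* suc N)} {0} {N} (ℚᵘ.*≤* (≡.subst₂ ℤ._≤_
      (ℤ.pos-* (suc a) (suc N)) (ℤ.pos-* (suc (suc a ℕ.* suc N)) 1)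
      (ℤ.+≤+ (ℕ.≤-trans (ℕ.n≤1+n _) (ℕ.≤-reflexive (sym (ℕ.*-identityʳ _)))))))

  if-elim : ∀ {P : Set} (C : ℕ → Set) (P? : Dec P) {m n} →
            (P → C m) → (¬ P → C n) → C (if does P? then m else n)
  if-elim C (yes p) f g = f p
  if-elim C (no ¬p) f g = g ¬p

  largestRoot-lower : ∀ q N M → largestRoot q N M ≡ 0 ⊎ sq (frac (largestRoot q N M) N) ℚ.≤ q
  largestRoot-lower q N zero    = inj₁ refl
  largestRoot-lower q N (suc m) =
    if-elim (λ k → k ≡ 0 ⊎ sq (frac k N) ℚ.≤ q) (sq (frac (suc m) N) ℚ.≤? q)
      inj₂ (λ _ → largestRoot-lower q N m)

  largestRoot-upper : ∀ q N M → q ℚ.< sq (frac (suc M) N) →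
                      q ℚ.< sq (frac (suc (largestRoot q N M)) N)
  largestRoot-upper q N zero    h = h
  largestRoot-upper q N (suc m) h =
    if-elim (λ k → q ℚ.< sq (frac (suc k) N)) (sq (frac (suc m) N) ℚ.≤? q)
      (λ _ → h) (λ k → largestRoot-upper q N m (ℚ.≰⇒> k))

open Root-Lemmas

approx√-nonNeg : ∀ q N → 0ℚ ℚ.≤ approx√ q N
approx√-nonNeg q N = 0≤frac (largestRoot q N (suc ℤ.∣ ↥ q ∣ ℕ.* suc N)) N

approx√-lower : ∀ q N → approx√ q N ≡ 0ℚ ⊎ sq (approx√ q N) ℚ.≤ q
approx√-lower q N = Sum.map₁
  (λ eq → trans (cong (λ m → frac m N) eq) (ℚ.0/n≡0 (suc N)))
  (largestRoot-lower q N (suc ℤ.∣ ↥ q ∣ ℕ.* suc N))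

approx√-upper : ∀ q N → q ℚ.< sq (approx√ q N ℚ.+ ι N)
approx√-upper q N = subst (λ p → q ℚ.< sq p) (frac-suc (largestRoot q N M) N)
  (largestRoot-upper q N M (cutoff q N))
  where M = suc ℤ.∣ ↥ q ∣ ℕ.* suc N

root-close : ∀ {p q a b i δ} → 0ℚ ℚ.≤ b → 0ℚ ℚ.≤ i → 0ℚ ℚ.< δ → i ℚ.≤ δ →
             a ≡ 0ℚ ⊎ sq a ℚ.≤ p → q ℚ.< sq (b ℚ.+ i) → p ℚ.< q ℚ.+ sq δ →
             a ℚ.≤ b ℚ.+ (δ ℚ.+ δ)
root-close {p} {q} {a} {b} {i} {δ} 0≤b 0≤i 0<δ i≤δ lower upper p<q+δ² =
  ℚ.≮⇒≥ λ b+2δ<a →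
    [ (λ a≡0  → ℚ.<-irrefl (sym a≡0) (0<a b+2δ<a))
    , (λ a²≤p → ℚ.<-asym p<q+δ²
        (ℚ.<-≤-trans q+δ²<[c+δ]² (ℚ.≤-trans ([c+δ]²≤a² b+2δ<a) a²≤p)))
    ]′ lower
  where
  c = b ℚ.+ i
  0≤δ = ℚ.<⇒≤ 0<δ
  0≤c : 0ℚ ℚ.≤ c
  0≤c = ℚ.+-mono-≤ 0≤b 0≤i
  c+δ<a : b ℚ.+ (δ ℚ.+ δ) ℚ.< a → c ℚ.+ δ ℚ.< a
  c+δ<a = ℚ.≤-<-trans
    (subst (c ℚ.+ δ ℚ.≤_) (ℚ.+-assoc b δ δ) (ℚ.+-monoˡ-≤ δ (ℚ.+-monoʳ-≤ b i≤δ)))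
  0<a : b ℚ.+ (δ ℚ.+ δ) ℚ.< a → 0ℚ ℚ.< a
  0<a h = ℚ.≤-<-trans (ℚ.+-mono-≤ 0≤c 0≤δ) (c+δ<a h)
  [c+δ]²≤a² : b ℚ.+ (δ ℚ.+ δ) ℚ.< a → sq (c ℚ.+ δ) ℚ.≤ sq a
  [c+δ]²≤a² h = sq-mono (ℚ.+-mono-≤ 0≤c 0≤δ) (ℚ.<⇒≤ (c+δ<a h))
  q+δ²<[c+δ]² : q ℚ.+ sq δ ℚ.< sq (c ℚ.+ δ)
  q+δ²<[c+δ]² = ℚ.<-≤-trans (ℚ.+-monoˡ-< (sq δ) upper)
    (≡.subst₂ ℚ._≤_ (ℚ.+-identityʳ (sq c ℚ.+ sq δ)) (sq-+ c δ)
      (ℚ.+-monoʳ-≤ (sq c ℚ.+ sq δ) (ℚ.+-mono-≤ (0≤p*q 0≤c 0≤δ) (0≤p*q 0≤c 0≤δ))))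

approx√-close : ∀ p q M N {δ} → 0ℚ ℚ.< δ → ι N ℚ.≤ δ → p ℚ.< q ℚ.+ sq δ →
                approx√ p M ℚ.≤ approx√ q N ℚ.+ (δ ℚ.+ δ)
approx√-close p q M N 0<δ ι≤δ =
  root-close (approx√-nonNeg q N) (ℚ.<⇒≤ (0<ι N)) 0<δ ι≤δ (approx√-lower p M) (approx√-upper q N)

-- √ x is the non-negative square root of x when 0 ≤ x, and 0 otherwise.
√_ : ℝ → ℝ
√ x = mkℝ (λ n → approx√ (seq x n) n) isCauchy
  where
  isCauchy : IsCauchy (λ n → approx√ (seq x n) n)
  isCauchy ε 0<ε =
    let δ     = half (half ε)
        0<δ   = 0<half (0<half 0<ε)
        M , h = cauchy x (sq δ) (0<p*q 0<δ 0<δ)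
        N , k = archimedean δ 0<δ
        close = λ m n (≤m : M ℕ.⊔ N ℕ.≤ m) (≤n : M ℕ.⊔ N ℕ.≤ n) →
          approx√-close (seq x m) (seq x n) m n 0<δ (k n (ℕ.m⊔n≤o⇒n≤o M N ≤n))
            (∣p-q∣<ε⇒p<q+ε (seq x m) (seq x n)
              (h m n (ℕ.m⊔n≤o⇒m≤o M N ≤m) (ℕ.m⊔n≤o⇒m≤o M N ≤n)))
    in M ℕ.⊔ N , λ m n ≤m ≤n → ℚ.≤-<-trans
         (∣p-q∣≤ε (close m n ≤m ≤n) (close n m ≤n ≤m))
         (subst (ℚ._< ε) (sym (half+half (half ε))) (half< 0<ε))

------------------------------------------------------------------------
-- Euclidean space

ℝ^ : ℕ → Set
ℝ^ n = Vector ℝ n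

ℝ^-setoid : ℕ → Setoid 0ℓ 0ℓ
ℝ^-setoid = VectorEquality.≋-setoid ≈-setoid

+-rawMonoid : RawMonoid 0ℓ 0ℓ
+-rawMonoid = record { Carrier = ℝ ; _≈_ = _≈_ ; _∙_ = _+_ ; ε = 0ℝ }

open RawMonoidDefs +-rawMonoid public using (sum)

infixl 6 _-ᵥ_

_-ᵥ_ : ∀ {n} → ℝ^ n → ℝ^ n → ℝ^ n
_-ᵥ_ = zipWith _-_

‖_‖ : ∀ {n} → ℝ^ n → ℝ
‖ x ‖ = √ sum (map (λ t → t * t) x)

dist : ∀ {n} → ℝ^ n → ℝ^ n → ℝ
dist x y = ‖ x -ᵥ y ‖

Ball : (D : ℕ) → ℝ → Pred (ℝ^ D) 0ℓ
Ball D r x = ‖ x ‖ ≤ r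

------------------------------------------------------------------------
-- Point sets

Points : ∀ {n} → Pred (ℝ^ n) 0ℓ → Setoid 0ℓ 0ℓ
Points {n} A = On.setoid {B = Σ (ℝ^ n) A} (ℝ^-setoid n) proj₁

Finite : ∀ {n} → Pred (ℝ^ n) 0ℓ → Set
Finite {n} A = ∃[ xs ] (∀ x → x ∈ A ⇔ x ∈ₗ xs)
  where open Membership (ℝ^-setoid n) using () renaming (_∈_ to _∈ₗ_)

OnSphereOfRadius : ∀ {n} → Pred (ℝ^ n) 0ℓ → ℝ → Set
OnSphereOfRadius {n} A ρ = 0ℝ ≤ ρ × ∃[ c ] (∀ x → x ∈ A → ‖ x -ᵥ c ‖ ≈ ρ)

Spherical : ∀ {n} → Pred (ℝ^ n) 0ℓ → Set
Spherical A = ∃[ ρ ] OnSphereOfRadius A ρ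

IsCircumradius : ∀ {n} → Pred (ℝ^ n) 0ℓ → ℝ → Set
IsCircumradius A ρ = OnSphereOfRadius A ρ × (∀ ρ′ → OnSphereOfRadius A ρ′ → ρ ≤ ρ′)

Congruent : ∀ {m n} → Pred (ℝ^ m) 0ℓ → Pred (ℝ^ n) 0ℓ → Set
Congruent A B = Σ[ f ∈ Bijection (Points A) (Points B) ]
  (let open Bijection f using (to) in
   ∀ x y → dist (proj₁ (to x)) (proj₁ (to y)) ≈ dist (proj₁ x) (proj₁ y))

-- A Func respects equality, so the colour of a point depends neither on the
-- Cauchy sequences representing it nor on the proof that it lies in A.
Colouring : ∀ {n} → Pred (ℝ^ n) 0ℓ → ℕ → Set
Colouring A k = Func (Points A) (≡.setoid (Fin k))

Monochromatic : ∀ {n k} {A : Pred (ℝ^ n) 0ℓ} → Colouring A k → Pred (ℝ^ n) 0ℓ → Set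
Monochromatic {A = A} χ B =
  ∀ (x y : Carrier (Points A)) → proj₁ x ∈ B → proj₁ y ∈ B → to x ≡ to y
  where
  open Setoid using (Carrier)
  open Func χ using (to)

{-# OPTIONS --safe #-}
-- Let y be the foot of the perpendicular from a centre of the circumsphere of A
-- to the affine span of A, measured from a point o of A, say y = Σ μᵢ (aᵢ - o).
-- Then o + y is equidistant from the points of A, so ρ² ≤ ‖y‖² by minimality of
-- the circumradius.  In a congruent copy with points bᵢ and b the copy of o, put
-- y′ = Σ μᵢ (bᵢ - b).  Distances determine inner products of differences, which
-- gives
--
--   0 ≤ ‖y′ + b‖² = ‖b‖² - ‖y‖² + Σ μᵢ (‖bᵢ‖² - ‖b‖²).
--
-- If every ‖bᵢ‖² is within ε of ‖b‖² ≤ r², then ρ² ≤ r² + ε Σ ∣μᵢ∣, which fails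
-- for small ε.  Hence it suffices to colour x by the interval of length ε that
-- contains ‖x‖².

module Submission where

open import Algebra.Bundles using (CommutativeRing)
import Algebra.Properties.Semiring.Mult
import Algebra.Properties.Semiring.Sum
import Algebra.Solver.Ring
open import Algebra.Solver.Ring.AlmostCommutativeRing
  using (fromCommutativeRing; _-Raw-AlmostCommutative⟶_)
open import Algebra.Structures using (IsCommutativeRing)
open import Axiom.ExcludedMiddle using (ExcludedMiddle)
open import Data.Fin.Base using (Fin; zero; suc)
open import Data.Fin.Properties using (suc-injective)
import Data.Integer.Base as ℤ
open import Data.List.Base as List using ([]; _∷_)
open import Data.List.Membership.Setoid.Properties using (∈-lookup)
open import Data.List.Relation.Unary.Any as Any using ()
open import Data.List.Relation.Unary.Any.Properties using (lookup-index)
open import Data.Maybe.Base as Maybe using ()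
open import Data.Nat.Base as ℕ using (ℕ; zero; suc; NonZero)
import Data.Nat.Properties as ℕ
open import Data.Product.Base using (∃-syntax; Σ-syntax; _×_; _,_; proj₁; proj₂)
open import Data.Rational.Base as ℚ using (ℚ; ½; 0ℚ; 1ℚ)
import Data.Rational.Properties as ℚ
open import Data.Rational.Solver using (module +-*-Solver)
open import Data.Sum.Base using (_⊎_; inj₁; inj₂)
open import Data.Vec.Functional as Vector using (Vector; tail; zipWith)
open import Function.Base using (_∘_)
open import Function.Bundles using (Bijection; Equivalence)
open import Level using (0ℓ)
open import Relation.Binary.Bundles using (Setoid)
open import Relation.Binary.Core using (Rel)
open import Relation.Binary.PropositionalEquality as ≡ using (_≡_)
import Relation.Binary.Reasoning.Setoid
open import Relation.Binary.Structures using (IsDecTotalOrder)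
open import Relation.Nullary using (¬_; Dec; yes; no; contradiction)
open import Relation.Nullary.Decidable using (dec⇒maybe)
open import Relation.Unary using (Pred; _⊆_; _∈_)

-- If all points of the copy had exactly equal norms, they would lie on a sphere about the origin of
-- radius at most `r`, which is less than the circumradius. The estimate is the quantitative form of
-- this observation, for norms known only up to `ε`. Nothing in it refers to `D`: the coefficients
-- μᵢ come from `A` and a centre alone, so `ε` and the number of intervals are fixed before the
-- dimension is. The points of `A` may be affinely dependent, so the projection has to tolerate
-- dependent vectors. The geometry uses only an archimedean ordered field with decidable order and
-- square roots of non-negative elements, and is carried out over an abstract field of this kind;
-- `¬ x ≤ y` serves there as the strict order. Excluded middle enters only when the Cauchy reals are
-- shown to be such a field: it decides the order and splits products and inverses by sign.

record EuclideanField : Set₁ where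
  infix 4 _≤_
  field
    commutativeRing : CommutativeRing 0ℓ 0ℓ
  open CommutativeRing commutativeRing public
  open Algebra.Properties.Semiring.Mult semiring public
    using (×-comm-*; ×-congʳ) renaming (_×_ to _⋆_)
  -- The embedding of ℚ supplies the coefficients of the ring solver.
  field
    rational        : ℚ.+-*-rawRing -Raw-AlmostCommutative⟶ fromCommutativeRing commutativeRing
    _≤_             : Rel Carrier 0ℓ
    isDecTotalOrder : IsDecTotalOrder _≈_ _≤_
    +-monoˡ-≤       : ∀ z {x y} → x ≤ y → x + z ≤ y + z
    0≤x*y           : ∀ {x y} → 0# ≤ x → 0# ≤ y → 0# ≤ x * y
    inverse         : ∀ x → ¬ x ≈ 0# → ∃[ y ] y * x ≈ 1#
    archimedean     : ∀ x → ∃[ k ] x ≤ k ⋆ 1#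
    √_              : Carrier → Carrier
    √-cong          : ∀ {x y} → x ≈ y → √ x ≈ √ y
    0≤√             : ∀ x → 0# ≤ √ x
    √x*√x≈x         : ∀ {x} → 0# ≤ x → √ x * √ x ≈ x

module Euclidean (F : EuclideanField) where
  open EuclideanField F hiding (zero)
  open IsDecTotalOrder isDecTotalOrder using (total; _≟_; _≤?_; antisym; ≤-respʳ-≈; ≤-respˡ-≈)
    renaming (refl to ≤-refl; reflexive to ≤-reflexive; trans to ≤-trans)
  open Algebra.Properties.Semiring.Sum semiring
    using (sum; sum-cong-≋; ∑-comm; *-distribˡ-sum; *-distribʳ-sum; ∑-distrib-+)
  open _-Raw-AlmostCommutative⟶_ rational using (⟦_⟧; 1-homo)
  open Algebra.Solver.Ring ℚ.+-*-rawRing (fromCommutativeRing commutativeRing) rational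
    (λ p q → Maybe.map (λ p≡q → reflexive (≡.cong ⟦_⟧ p≡q)) (dec⇒maybe (p ℚ.≟ q)))
    hiding (⟦_⟧)
  open Relation.Binary.Reasoning.Setoid setoid

  -- Arithmetic in an ordered field

  x≤y⇒0≤y-x : ∀ {x y} → x ≤ y → 0# ≤ y - x
  x≤y⇒0≤y-x {x} x≤y = ≤-respˡ-≈ (-‿inverseʳ x) (+-monoˡ-≤ (- x) x≤y)

  0≤y-x⇒x≤y : ∀ {x y} → 0# ≤ y - x → x ≤ y
  0≤y-x⇒x≤y {x} {y} h = ≤-respˡ-≈ (+-identityˡ x)
    (≤-respʳ-≈ (solve 2 (λ x y → (y :- x) :+ x := y) refl x y) (+-monoˡ-≤ x h))

  -- An inequality depends only on the difference of its sides, so rearranging one becomes a ring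
  -- identity for the solver.
  ≤-shift : ∀ {x y u v} → y - x ≈ v - u → x ≤ y → u ≤ v
  ≤-shift eq x≤y = 0≤y-x⇒x≤y (≤-respʳ-≈ eq (x≤y⇒0≤y-x x≤y))

  0≤x+y : ∀ {x y} → 0# ≤ x → 0# ≤ y → 0# ≤ x + y
  0≤x+y {x} {y} 0≤x 0≤y = ≤-trans 0≤y (≤-respˡ-≈ (+-identityˡ y) (+-monoˡ-≤ y 0≤x))

  +-mono-≤ : ∀ {x y u v} → x ≤ y → u ≤ v → x + u ≤ y + v
  +-mono-≤ {x} {y} {u} {v} x≤y u≤v = 0≤y-x⇒x≤y
    (≤-respʳ-≈ (solve 4 (λ x y u v → (y :- x) :+ (v :- u) := (y :+ v) :- (x :+ u)) refl x y u v)
      (0≤x+y (x≤y⇒0≤y-x x≤y) (x≤y⇒0≤y-x u≤v)))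

  0≤x*x : ∀ x → 0# ≤ x * x
  0≤x*x x with total 0# x
  ... | inj₁ 0≤x = 0≤x*y 0≤x 0≤x
  ... | inj₂ x≤0 = ≤-respʳ-≈ (solve 1 (λ x → :- x :* :- x := x :* x) refl x) (0≤x*y 0≤-x 0≤-x)
    where 0≤-x = ≤-respʳ-≈ (+-identityˡ (- x)) (x≤y⇒0≤y-x x≤0)

  0≤1 : 0# ≤ 1#
  0≤1 = ≤-respʳ-≈ (*-identityˡ 1#) (0≤x*x 1#)

  0≤sum : ∀ {n} {x : Fin n → Carrier} → (∀ i → 0# ≤ x i) → 0# ≤ sum x
  0≤sum {zero}  0≤x = ≤-refl
  0≤sum {suc n} 0≤x = 0≤x+y (0≤x zero) (0≤sum (0≤x ∘ suc))

  x≤x+y : ∀ x {y} → 0# ≤ y → x ≤ x + y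
  x≤x+y x {y} 0≤y = ≤-respˡ-≈ (+-identityˡ x) (≤-respʳ-≈ (+-comm y x) (+-monoˡ-≤ x 0≤y))

  x≤y+x : ∀ x {y} → 0# ≤ y → x ≤ y + x
  x≤y+x x {y} 0≤y = ≤-respʳ-≈ (+-comm x y) (x≤x+y x 0≤y)

  *-monoʳ-≤ : ∀ {x y z} → 0# ≤ z → x ≤ y → z * x ≤ z * y
  *-monoʳ-≤ {x} {y} {z} 0≤z x≤y = 0≤y-x⇒x≤y
    (≤-respʳ-≈ (solve 3 (λ x y z → z :* (y :- x) := z :* y :- z :* x) refl x y z)
      (0≤x*y 0≤z (x≤y⇒0≤y-x x≤y)))

  *-mono-square-≤ : ∀ {x y} → 0# ≤ x → x ≤ y → x * x ≤ y * y
  *-mono-square-≤ {x} {y} 0≤x x≤y = 0≤y-x⇒x≤y (≤-respʳ-≈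
    (solve 2 (λ x y → (y :- x) :* (y :+ x) := y :* y :- x :* x) refl x y)
    (0≤x*y (x≤y⇒0≤y-x x≤y) (0≤x+y (≤-trans 0≤x x≤y) 0≤x)))

  -- y = y² x
  inverse-nonNeg : ∀ {x y} → 0# ≤ x → y * x ≈ 1# → 0# ≤ y
  inverse-nonNeg {x} {y} 0≤x yx≈1 = ≤-respʳ-≈
    (trans (*-assoc y y x) (trans (*-congˡ yx≈1) (*-identityʳ y)))
    (0≤x*y (0≤x*x y) 0≤x)

  x*x≈0⇒x≈0 : ∀ {x} → x * x ≈ 0# → x ≈ 0#
  x*x≈0⇒x≈0 {x} xx≈0 with x ≟ 0#
  ... | yes x≈0 = x≈0
  ... | no  x≉0 with inverse x x≉0
  ...   | y , yx≈1 = begin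
    x           ≈⟨ *-identityˡ x ⟨
    1# * x      ≈⟨ *-congʳ yx≈1 ⟨
    y * x * x   ≈⟨ *-assoc y x x ⟩
    y * (x * x) ≈⟨ *-congˡ xx≈0 ⟩
    y * 0#      ≈⟨ zeroʳ y ⟩
    0#          ∎

  -- If y ≤ x then (x − y)² ≤ x² − y².
  square-cancel-≤ : ∀ {x y} → 0# ≤ y → x * x ≤ y * y → x ≤ y
  square-cancel-≤ {x} {y} 0≤y xx≤yy with total x y
  ... | inj₁ x≤y = x≤y
  ... | inj₂ y≤x = ≤-shift
      (trans (+-identityˡ _) (solve 2 (λ x y → :- (x :- y) := y :- x) refl x y))
      (≤-reflexive (x*x≈0⇒x≈0 (antisym [x-y]²≤0 (0≤x*x (x - y)))))
    where
    0≤2y[x-y] : 0# ≤ (y + y) * (x - y)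
    0≤2y[x-y] = 0≤x*y (0≤x+y 0≤y 0≤y) (x≤y⇒0≤y-x y≤x)
    [x-y]²≤0 : (x - y) * (x - y) ≤ 0#
    [x-y]²≤0 = ≤-trans (x≤x+y _ 0≤2y[x-y]) (≤-shift
      (trans (solve 2 (λ x y → y :* y :- x :* x := :- ((x :- y) :* (x :- y) :+ (y :+ y) :* (x :- y))) refl x y)
        (sym (+-identityˡ _))) xx≤yy)

  -- Dividing an interval into buckets

  ⋆≈* : ∀ k x → k ⋆ x ≈ x * (k ⋆ 1#)
  ⋆≈* k x = sym (trans (×-comm-* k x 1#) (×-congʳ k (*-identityʳ x)))

  -- The two hypotheses on `δ` encode positivity; division by `δ` reduces to multiples of `1#`.
  archimedean′ : ∀ x {δ} → 0# ≤ δ → ¬ δ ≈ 0# → ∃[ k ] x ≤ k ⋆ δ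
  archimedean′ x {δ} 0≤δ δ≉0 =
    let η , ηδ≈1 = inverse δ δ≉0
        k , h    = archimedean (η * x)
    in k , ≤-respʳ-≈ (sym (⋆≈* k δ)) (≤-respˡ-≈
         (trans (solve 3 (λ δ η x → δ :* (η :* x) := η :* δ :* x) refl δ η x)
           (trans (*-congʳ ηδ≈1) (*-identityˡ x)))
         (*-monoʳ-≤ 0≤δ h))

  -- Intended for 0 ≤ x ≤ (k + 1) δ: larger x end up in the last bucket.
  bucket : (k : ℕ) → Carrier → Carrier → Fin (suc k)
  bucket zero    δ x = zero
  bucket (suc k) δ x with x ≤? δ
  ... | yes _ = zero
  ... | no  _ = suc (bucket k δ (x - δ))

  bucket-cong : ∀ k δ {x y} → x ≈ y → bucket k δ x ≡ bucket k δ y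
  bucket-cong zero    δ x≈y = ≡.refl
  bucket-cong (suc k) δ {x} {y} x≈y with x ≤? δ | y ≤? δ
  ... | yes _   | yes _   = ≡.refl
  ... | yes x≤δ | no  y≰δ = contradiction (≤-respˡ-≈ x≈y x≤δ) y≰δ
  ... | no  x≰δ | yes y≤δ = contradiction (≤-respˡ-≈ (sym x≈y) y≤δ) x≰δ
  ... | no  _   | no  _   = ≡.cong suc (bucket-cong k δ (+-congʳ x≈y))

  ≰⇒≥ : ∀ {x y} → ¬ x ≤ y → y ≤ x
  ≰⇒≥ {x} {y} x≰y with total x y
  ... | inj₁ x≤y = contradiction x≤y x≰y
  ... | inj₂ y≤x = y≤x

  -- Subtracting `δ` from both points preserves their difference, so the induction descends until
  -- both stop in the same interval.
  bucket-close : ∀ k δ {x y} → 0# ≤ x → 0# ≤ y → x ≤ suc k ⋆ δ → y ≤ suc k ⋆ δ →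
                 bucket k δ x ≡ bucket k δ y → x ≤ y + δ
  -- The last bucket performs no test; its upper end comes from the hypothesis on `x`, where `1 ⋆ δ`
  -- unfolds to `δ + 0#`.
  bucket-close zero δ 0≤x 0≤y x≤δ y≤δ _ =
    ≤-trans (≤-respʳ-≈ (+-comm δ 0#) x≤δ) (+-monoˡ-≤ δ 0≤y)
  bucket-close (suc k) δ {x} {y} 0≤x 0≤y x≤ y≤ eq with x ≤? δ | y ≤? δ
  ... | yes x≤δ | yes _   = ≤-trans x≤δ (x≤y+x δ 0≤y)
  ... | no  x≰δ | no  y≰δ = ≤-shift
    (solve 3 (λ x y δ → y :- δ :+ δ :- (x :- δ) := y :+ δ :- x) refl x y δ)
    (bucket-close k δ (x≤y⇒0≤y-x (≰⇒≥ x≰δ)) (x≤y⇒0≤y-x (≰⇒≥ y≰δ))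
      (lower x≤) (lower y≤) (suc-injective eq))
    where
    lower : ∀ {z} → z ≤ δ + suc k ⋆ δ → z - δ ≤ suc k ⋆ δ
    lower {z} = ≤-shift (solve 3 (λ z δ s → δ :+ s :- z := s :- (z :- δ)) refl z δ (suc k ⋆ δ))

  -- Inner products in coordinate space

  Space : ℕ → Set
  Space = Vector Carrier

  infixl 6 _⊕_ _⊖_

  _⊕_ _⊖_ : ∀ {n} → Space n → Space n → Space n
  _⊕_ = zipWith _+_
  _⊖_ = zipWith _-_

  ⟨_,_⟩ : ∀ {n} → Space n → Space n → Carrier
  ⟨ x , y ⟩ = sum (λ i → x i * y i)

  sqNorm : ∀ {n} → Space n → Carrier
  sqNorm x = ⟨ x , x ⟩

  combination : ∀ {m n} → Space m → (Fin m → Space n) → Space n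
  combination μ u k = ⟨ μ , (λ i → u i k) ⟩

  ⟨⟩-cong : ∀ {n} {x x′ y y′ : Space n} → (∀ i → x i ≈ x′ i) → (∀ i → y i ≈ y′ i) →
            ⟨ x , y ⟩ ≈ ⟨ x′ , y′ ⟩
  ⟨⟩-cong x≈ y≈ = sum-cong-≋ (λ i → *-cong (x≈ i) (y≈ i))

  ⟨⟩-comm : ∀ {n} (x y : Space n) → ⟨ x , y ⟩ ≈ ⟨ y , x ⟩
  ⟨⟩-comm x y = sum-cong-≋ (λ i → *-comm (x i) (y i))

  ⟨⊖⟩ : ∀ {n} (x y z : Space n) → ⟨ x ⊖ y , z ⟩ ≈ ⟨ x , z ⟩ - ⟨ y , z ⟩
  ⟨⊖⟩ {zero}  x y z = sym (-‿inverseʳ 0#)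
  ⟨⊖⟩ {suc n} x y z = trans (+-congˡ (⟨⊖⟩ (tail x) (tail y) (tail z)))
    (solve 5 (λ x y z a b → (x :- y) :* z :+ (a :- b) := (x :* z :+ a) :- (y :* z :+ b)) refl
      (x zero) (y zero) (z zero) _ _)

  ⟨⟩-distribˡ-⊕ : ∀ {n} (x y z : Space n) → ⟨ x , y ⊕ z ⟩ ≈ ⟨ x , y ⟩ + ⟨ x , z ⟩
  ⟨⟩-distribˡ-⊕ x y z = trans (sum-cong-≋ (λ i → distribˡ (x i) (y i) (z i)))
    (∑-distrib-+ (λ i → x i * y i) (λ i → x i * z i))

  ⟨scale⟩ : ∀ {n} c (x y : Space n) → ⟨ (λ i → c * x i) , y ⟩ ≈ c * ⟨ x , y ⟩
  ⟨scale⟩ c x y = trans (sum-cong-≋ (λ i → *-assoc c (x i) (y i)))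
    (sym (*-distribˡ-sum c (λ i → x i * y i)))

  ⟨combination⟩ : ∀ {m n} (μ : Space m) (u : Fin m → Space n) z →
                  ⟨ combination μ u , z ⟩ ≈ ⟨ μ , (λ i → ⟨ u i , z ⟩) ⟩
  ⟨combination⟩ μ u z = begin
    sum (λ k → sum (λ i → μ i * u i k) * z k)
      ≈⟨ sum-cong-≋ (λ k → *-distribʳ-sum (z k) (λ i → μ i * u i k)) ⟩
    sum (λ k → sum (λ i → μ i * u i k * z k))
      ≈⟨ ∑-comm (λ k i → μ i * u i k * z k) ⟩
    sum (λ i → sum (λ k → μ i * u i k * z k))
      ≈⟨ sum-cong-≋ (λ i → ⟨scale⟩ (μ i) (u i) z) ⟩
    sum (λ i → μ i * ⟨ u i , z ⟩) ∎

  sqNorm-⊕ : ∀ {n} (x y : Space n) → sqNorm (x ⊕ y) ≈ sqNorm x + (⟨ x , y ⟩ + ⟨ x , y ⟩) + sqNorm y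
  sqNorm-⊕ {zero}  x y = trans (sym (+-identityʳ 0#)) (+-congʳ (sym (trans (+-identityˡ _) (+-identityʳ _))))
  sqNorm-⊕ {suc n} x y = trans (+-congˡ (sqNorm-⊕ (tail x) (tail y)))
    (solve 5 (λ x y p q r → (x :+ y) :* (x :+ y) :+ (p :+ (q :+ q) :+ r)
       := x :* x :+ p :+ (x :* y :+ q :+ (x :* y :+ q)) :+ (y :* y :+ r)) refl
      (x zero) (y zero) _ _ _)

  sqNorm-⊖ : ∀ {n} (x y : Space n) → sqNorm (x ⊖ y) ≈ sqNorm x - (⟨ y , x ⟩ + ⟨ y , x ⟩) + sqNorm y
  sqNorm-⊖ {zero}  x y = sym (trans (+-identityʳ _)
    (trans (+-congˡ (-‿cong (+-identityˡ 0#))) (-‿inverseʳ 0#)))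
  sqNorm-⊖ {suc n} x y = trans (+-congˡ (sqNorm-⊖ (tail x) (tail y)))
    (solve 5 (λ x y p q r → (x :- y) :* (x :- y) :+ (p :- (q :+ q) :+ r)
       := x :* x :+ p :- (y :* x :+ q :+ (y :* x :+ q)) :+ (y :* y :+ r)) refl
      (x zero) (y zero) _ _ _)

  0≤sqNorm : ∀ {n} (x : Space n) → 0# ≤ sqNorm x
  0≤sqNorm {zero}  x = ≤-refl
  0≤sqNorm {suc n} x = 0≤x+y (0≤x*x (x zero)) (0≤sqNorm (tail x))

  sqNorm≈0⇒≈0 : ∀ {n} (x : Space n) → sqNorm x ≈ 0# → ∀ i → x i ≈ 0#
  sqNorm≈0⇒≈0 x Nx≈0 zero    = x*x≈0⇒x≈0 (antisym
    (≤-respʳ-≈ Nx≈0 (x≤x+y _ (0≤sqNorm (tail x)))) (0≤x*x (x zero)))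
  sqNorm≈0⇒≈0 x Nx≈0 (suc i) = sqNorm≈0⇒≈0 (tail x) (antisym
    (≤-respʳ-≈ Nx≈0 (x≤y+x _ (0≤x*x (x zero)))) (0≤sqNorm (tail x))) i

  ⟨≈0⟩ : ∀ {n} {x : Space n} (y : Space n) → (∀ i → x i ≈ 0#) → ⟨ x , y ⟩ ≈ 0#
  ⟨≈0⟩ {n} {x} y x≈0 = begin
    ⟨ x , y ⟩                   ≈⟨ ⟨⟩-cong (λ i → trans (x≈0 i) (sym (zeroˡ 0#))) (λ _ → refl) ⟩
    ⟨ (λ _ → 0# * 0#) , y ⟩     ≈⟨ ⟨scale⟩ 0# (λ _ → 0#) y ⟩
    0# * ⟨ (λ _ → 0#) , y ⟩     ≈⟨ zeroˡ _ ⟩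
    0#                          ∎

  -- Orthogonal projection onto a span

  ⟂-combination : ∀ {m n} (x : Space n) (μ : Space m) (u : Fin m → Space n) →
                  (∀ j → ⟨ x , u j ⟩ ≈ 0#) → ⟨ x , combination μ u ⟩ ≈ 0#
  ⟂-combination x μ u x⟂u = begin
    ⟨ x , combination μ u ⟩        ≈⟨ ⟨⟩-comm x _ ⟩
    ⟨ combination μ u , x ⟩        ≈⟨ ⟨combination⟩ μ u x ⟩
    ⟨ μ , (λ i → ⟨ u i , x ⟩) ⟩    ≈⟨ ⟨⟩-comm μ _ ⟩
    ⟨ (λ i → ⟨ u i , x ⟩) , μ ⟩    ≈⟨ ⟨≈0⟩ μ (λ j → trans (⟨⟩-comm (u j) x) (x⟂u j)) ⟩
    0#                             ∎

  -- A Gram–Schmidt step: v is the part of u₀ orthogonal to the other vectors, and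
  -- the residual r of w still has to be corrected along v.
  projection : ∀ {m n} (u : Fin m → Space n) (w : Space n) →
               ∃[ μ ] (∀ j → ⟨ w ⊖ combination μ u , u j ⟩ ≈ 0#)
  projection {zero}  u w = (λ ()) , λ ()
  -- These are the coefficients of `combination μ u′` plus `τ` times `v`, collected along `u₀` and
  -- `u′`.
  projection {suc m} u w = (τ Vector.∷ λ i → μ i - τ * ν i) , orthogonal
    where
    u₀ = u zero
    u′ = tail u
    ν  = proj₁ (projection u′ u₀)
    μ  = proj₁ (projection u′ w)
    v  = u₀ ⊖ combination ν u′
    r  = w ⊖ combination μ u′
    v⟂u′ = proj₂ (projection u′ u₀)
    r⟂u′ = proj₂ (projection u′ w)

    coefficient : ∃[ τ ] ⟨ r , v ⟩ ≈ τ * sqNorm v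
    coefficient with sqNorm v ≟ 0#
    -- Here `u₀` depends linearly on `u′`: `v` vanishes, any `τ` would do, and `0#` is the default.
    ... | yes Nv≈0 = 0# , (begin
      ⟨ r , v ⟩       ≈⟨ ⟨⟩-comm r v ⟩
      ⟨ v , r ⟩       ≈⟨ ⟨≈0⟩ r (sqNorm≈0⇒≈0 v Nv≈0) ⟩
      0#              ≈⟨ zeroˡ (sqNorm v) ⟨
      0# * sqNorm v   ∎)
    ... | no Nv≉0 with inverse (sqNorm v) Nv≉0
    ...   | η , η*Nv≈1 = ⟨ r , v ⟩ * η , sym (trans (*-assoc _ η (sqNorm v))
      (trans (*-congˡ η*Nv≈1) (*-identityʳ _)))

    τ = proj₁ coefficient

    r′ = w ⊖ combination (τ Vector.∷ λ i → μ i - τ * ν i) u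

    ⟨r′,_⟩ : ∀ z → ⟨ r′ , z ⟩ ≈ ⟨ r , z ⟩ - τ * ⟨ v , z ⟩
    ⟨r′, z ⟩ = begin
      ⟨ r′ , z ⟩
        ≈⟨ ⟨⟩-cong (λ k → trans
             (+-congˡ (-‿cong (+-congˡ (trans (⟨⊖⟩ μ _ (λ i → u′ i k)) (+-congˡ (-‿cong (⟨scale⟩ τ ν _)))))))
             (solve 5 (λ w τ u a b → w :- (τ :* u :+ (a :- τ :* b)) := w :- a :- τ :* (u :- b)) refl
               (w k) τ (u₀ k) (combination μ u′ k) (combination ν u′ k)))
             (λ _ → refl) ⟩
      ⟨ r ⊖ (λ k → τ * v k) , z ⟩
        ≈⟨ ⟨⊖⟩ r _ z ⟩
      ⟨ r , z ⟩ - ⟨ (λ k → τ * v k) , z ⟩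
        ≈⟨ +-congˡ (-‿cong (⟨scale⟩ τ v z)) ⟩
      ⟨ r , z ⟩ - τ * ⟨ v , z ⟩ ∎

    -- `u₀` and `v` differ by a combination of the `u′ j`, to which `x` is orthogonal.
    ⟨_,u₀⟩ : ∀ x → (∀ j → ⟨ x , u′ j ⟩ ≈ 0#) → ⟨ x , u₀ ⟩ ≈ ⟨ x , v ⟩
    ⟨ x ,u₀⟩ x⟂u′ = begin
      ⟨ x , u₀ ⟩                                 ≈⟨ ⟨⟩-comm x u₀ ⟩
      ⟨ u₀ , x ⟩                                 ≈⟨ solve 2 (λ a b → a := a :- b :+ b) refl _ _ ⟩
      ⟨ u₀ , x ⟩ - ⟨ combination ν u′ , x ⟩ + ⟨ combination ν u′ , x ⟩
        ≈⟨ +-cong (⟨⊖⟩ u₀ _ x) (⟨⟩-comm x _) ⟨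
      ⟨ v , x ⟩ + ⟨ x , combination ν u′ ⟩
        ≈⟨ +-cong (⟨⟩-comm v x) (⟂-combination x ν u′ x⟂u′) ⟩
      ⟨ x , v ⟩ + 0#                             ≈⟨ +-identityʳ _ ⟩
      ⟨ x , v ⟩                                  ∎

    orthogonal : ∀ j → ⟨ r′ , u j ⟩ ≈ 0#
    orthogonal zero = begin
      ⟨ r′ , u₀ ⟩                   ≈⟨ ⟨r′, u₀ ⟩ ⟩
      ⟨ r , u₀ ⟩ - τ * ⟨ v , u₀ ⟩   ≈⟨ +-cong (⟨ r ,u₀⟩ r⟂u′) (-‿cong (*-congˡ (⟨ v ,u₀⟩ v⟂u′))) ⟩
      ⟨ r , v ⟩ - τ * sqNorm v      ≈⟨ +-congʳ (proj₂ coefficient) ⟩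
      τ * sqNorm v - τ * sqNorm v   ≈⟨ -‿inverseʳ _ ⟩
      0#                            ∎
    orthogonal (suc j) = begin
      ⟨ r′ , u′ j ⟩                     ≈⟨ ⟨r′, u′ j ⟩ ⟩
      ⟨ r , u′ j ⟩ - τ * ⟨ v , u′ j ⟩   ≈⟨ +-cong (r⟂u′ j) (-‿cong (*-congˡ (v⟂u′ j))) ⟩
      0# - τ * 0#                       ≈⟨ +-congˡ (-‿cong (zeroʳ τ)) ⟩
      0# - 0#                           ≈⟨ -‿inverseʳ 0# ⟩
      0#                                ∎

  -- Inner products from distances, and the estimate for a congruent copy

  ½# : Carrier
  ½# = ⟦ ½ ⟧

  -- The law of cosines, verified coordinate by coordinate.
  polarization : ∀ {n} (x y z : Space n) →
                 ⟨ x ⊖ z , y ⊖ z ⟩ ≈ ½# * (sqNorm (x ⊖ z) + sqNorm (y ⊖ z) - sqNorm (x ⊖ y))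
  polarization {zero}  x y z = sym (trans (*-congˡ (trans (+-congʳ (+-identityˡ 0#)) (-‿inverseʳ 0#))) (zeroʳ ½#))
  polarization {suc n} x y z = trans (+-congˡ (polarization (tail x) (tail y) (tail z)))
    (solve 6 (λ x y z a b c →
         (x :- z) :* (y :- z) :+ con ½ :* (a :+ b :- c)
      := con ½ :* ((x :- z) :* (x :- z) :+ a :+ ((y :- z) :* (y :- z) :+ b) :- ((x :- y) :* (x :- y) :+ c)))
      refl (x zero) (y zero) (z zero) _ _ _)

  -- Only the Gram matrix of `u` enters, so the same coefficients give the same norm in a congruent
  -- configuration.
  sqNorm-combination : ∀ {m n} (μ : Space m) (u : Fin m → Space n) →
                  sqNorm (combination μ u) ≈ ⟨ μ , (λ i → ⟨ μ , (λ j → ⟨ u j , u i ⟩) ⟩) ⟩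
  sqNorm-combination μ u = trans (⟨combination⟩ μ u _)
    (⟨⟩-cong (λ _ → refl) (λ i → trans (⟨⟩-comm (u i) _) (⟨combination⟩ μ u (u i))))

  -- A polynomial substitute for twice the absolute value, since 2∣x∣ ≤ 1 + x². The unit is written
  -- as the image of a rational so that it matches a solver constant.
  weight : Carrier → Carrier
  weight x = ⟦ ℚ.1ℚ ⟧ + x * x

  -- (1 + μ)² (ε − δ) + (1 − μ)² (ε + δ) = 2 ((1 + μ²) ε − 2 μ δ)
  2μδ≤weight*ε : ∀ μ {δ ε} → 0# ≤ ε - δ → 0# ≤ ε + δ → μ * δ + μ * δ ≤ weight μ * ε
  2μδ≤weight*ε μ {δ} {ε} δ≤ε -ε≤δ = 0≤y-x⇒x≤y (≤-respʳ-≈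
    (solve 3 (λ μ δ ε →
         (con ½ :* (con ℚ.1ℚ :+ μ)) :* (con ½ :* (con ℚ.1ℚ :+ μ)) :* (ε :- δ :+ (ε :- δ))
      :+ (con ½ :* (con ℚ.1ℚ :- μ)) :* (con ½ :* (con ℚ.1ℚ :- μ)) :* (ε :+ δ :+ (ε :+ δ))
      := (con ℚ.1ℚ :+ μ :* μ) :* ε :- (μ :* δ :+ μ :* δ)) refl μ δ ε)
    (0≤x+y (0≤x*y (0≤x*x _) (0≤x+y δ≤ε δ≤ε)) (0≤x*y (0≤x*x _) (0≤x+y -ε≤δ -ε≤δ))))

  2⟨μ,δ⟩≤weights*ε : ∀ {m} (μ δ : Space m) {ε} → (∀ i → 0# ≤ ε - δ i) → (∀ i → 0# ≤ ε + δ i) →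
                     ⟨ μ , δ ⟩ + ⟨ μ , δ ⟩ ≤ sum (λ i → weight (μ i)) * ε
  2⟨μ,δ⟩≤weights*ε {zero}  μ δ {ε} _ _ = ≤-reflexive (trans (+-identityˡ 0#) (sym (zeroˡ ε)))
  2⟨μ,δ⟩≤weights*ε {suc m} μ δ {ε} δ≤ε -ε≤δ = ≤-respˡ-≈
    (solve 3 (λ μ δ a → μ :* δ :+ μ :* δ :+ (a :+ a) := μ :* δ :+ a :+ (μ :* δ :+ a)) refl (μ zero) (δ zero) _)
    (≤-respʳ-≈ (sym (distribʳ ε _ _))
      (+-mono-≤ (2μδ≤weight*ε (μ zero) (δ≤ε zero) (-ε≤δ zero))
                (2⟨μ,δ⟩≤weights*ε (tail μ) (tail δ) (δ≤ε ∘ suc) (-ε≤δ ∘ suc))))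

  -- Here o + y is the centre of a sphere through the points o and o + uᵢ, while
  -- the points b and b + vᵢ are a congruent configuration.
  centre-bound : ∀ {m n D} (μ : Space m) (u : Fin m → Space n) (v : Fin m → Space D) (b : Space D) {ε} →
    let y = combination μ u in
    (∀ i j → ⟨ v i , v j ⟩ ≈ ⟨ u i , u j ⟩) →
    (∀ i → sqNorm (u i) ≈ ⟨ y , u i ⟩ + ⟨ y , u i ⟩) →
    (∀ i → sqNorm (v i ⊕ b) ≤ sqNorm b + ε) → (∀ i → sqNorm b ≤ sqNorm (v i ⊕ b) + ε) →
    sqNorm y + sqNorm y ≤ sum (λ i → weight (μ i)) * ε + (sqNorm b + sqNorm b)
  -- The difference of the two sides is the slack `W * ε - 2⟨μ,δ⟩` plus `2S`, both non-negative. The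
  -- terms in `p`, which depend on the position of the copy, cancel.
  centre-bound μ u v b {ε} gram centre upper lower = 0≤y-x⇒x≤y (≤-respʳ-≈ (begin
      W * ε - (⟨ μ , δ ⟩ + ⟨ μ , δ ⟩) + (S + S)
        ≈⟨ +-cong (+-congˡ (-‿cong (+-cong ⟨μ,δ⟩≈ ⟨μ,δ⟩≈))) (+-cong S≈ S≈) ⟩
      W * ε - ((sqNorm y + p + (sqNorm y + p)) + (sqNorm y + p + (sqNorm y + p)))
        + ((sqNorm y + (p + p) + sqNorm b) + (sqNorm y + (p + p) + sqNorm b))
        ≈⟨ solve 4 (λ w y p b →
             w :- ((y :+ p :+ (y :+ p)) :+ (y :+ p :+ (y :+ p))) :+ ((y :+ (p :+ p) :+ b) :+ (y :+ (p :+ p) :+ b))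
             := w :+ (b :+ b) :- (y :+ y)) refl (W * ε) (sqNorm y) p (sqNorm b) ⟩
      W * ε + (sqNorm b + sqNorm b) - (sqNorm y + sqNorm y) ∎)
    (0≤x+y (x≤y⇒0≤y-x (2⟨μ,δ⟩≤weights*ε μ δ δ≤ε -ε≤δ)) (0≤x+y (0≤sqNorm (y′ ⊕ b)) (0≤sqNorm (y′ ⊕ b)))))
    where
    W  = sum (λ i → weight (μ i))
    y  = combination μ u
    y′ = combination μ v
    δ  = λ i → sqNorm (v i ⊕ b) - sqNorm b
    S  = sqNorm (y′ ⊕ b)
    p  = ⟨ y′ , b ⟩

    S≈ : S ≈ sqNorm y + (p + p) + sqNorm b
    S≈ = trans (sqNorm-⊕ y′ b) (+-congʳ (+-congʳ (begin
      sqNorm y′                                        ≈⟨ sqNorm-combination μ v ⟩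
      ⟨ μ , (λ i → ⟨ μ , (λ j → ⟨ v j , v i ⟩) ⟩) ⟩
        ≈⟨ ⟨⟩-cong (λ _ → refl) (λ i → ⟨⟩-cong (λ _ → refl) (λ j → gram j i)) ⟩
      ⟨ μ , (λ i → ⟨ μ , (λ j → ⟨ u j , u i ⟩) ⟩) ⟩    ≈⟨ sqNorm-combination μ u ⟨
      sqNorm y                                         ∎)))

    -- By `gram` and `centre`, the quadratic term `sqNorm (v i)` equals `2⟨u i , y⟩`. Hence `δ i` is
    -- linear in `u i` and `v i`, and weighting by `μ` turns these into `y` and `y′`.
    ⟨μ,δ⟩≈ : ⟨ μ , δ ⟩ ≈ sqNorm y + p + (sqNorm y + p)
    ⟨μ,δ⟩≈ = begin
      ⟨ μ , δ ⟩
        ≈⟨ ⟨⟩-cong (λ _ → refl) (λ i → begin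
             sqNorm (v i ⊕ b) - sqNorm b
               ≈⟨ +-congʳ (sqNorm-⊕ (v i) b) ⟩
             sqNorm (v i) + (⟨ v i , b ⟩ + ⟨ v i , b ⟩) + sqNorm b - sqNorm b
               ≈⟨ +-congʳ (+-congʳ (+-congʳ (trans (gram i i) (trans (centre i) (+-cong (⟨⟩-comm y (u i)) (⟨⟩-comm y (u i))))))) ⟩
             ⟨ u i , y ⟩ + ⟨ u i , y ⟩ + (⟨ v i , b ⟩ + ⟨ v i , b ⟩) + sqNorm b - sqNorm b
               ≈⟨ solve 3 (λ u v b → u :+ u :+ (v :+ v) :+ b :- b := u :+ v :+ (u :+ v)) refl _ _ _ ⟩
             ⟨ u i , y ⟩ + ⟨ v i , b ⟩ + (⟨ u i , y ⟩ + ⟨ v i , b ⟩) ∎) ⟩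
      ⟨ μ , ((f ⊕ g) ⊕ (f ⊕ g)) ⟩
        ≈⟨ ⟨⟩-distribˡ-⊕ μ (f ⊕ g) (f ⊕ g) ⟩
      ⟨ μ , (f ⊕ g) ⟩ + ⟨ μ , (f ⊕ g) ⟩
        ≈⟨ +-cong half half ⟩
      sqNorm y + p + (sqNorm y + p) ∎
      where
      f = λ i → ⟨ u i , y ⟩
      g = λ i → ⟨ v i , b ⟩
      half : ⟨ μ , (f ⊕ g) ⟩ ≈ sqNorm y + p
      half = trans (⟨⟩-distribˡ-⊕ μ f g) (sym (+-cong (⟨combination⟩ μ u y) (⟨combination⟩ μ v b)))

    δ≤ε : ∀ i → 0# ≤ ε - δ i
    δ≤ε i = ≤-respʳ-≈ (solve 3 (λ ε a b → b :+ ε :- a := ε :- (a :- b)) refl ε _ _) (x≤y⇒0≤y-x (upper i))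

    -ε≤δ : ∀ i → 0# ≤ ε + δ i
    -ε≤δ i = ≤-respʳ-≈ (solve 3 (λ ε a b → a :+ ε :- b := ε :+ (a :- b)) refl ε _ _) (x≤y⇒0≤y-x (lower i))

  distance-determines-gram : ∀ {m n D} (a : Fin m → Space n) (b : Fin m → Space D) (o : Fin m) →
    (∀ i j → sqNorm (b i ⊖ b j) ≈ sqNorm (a i ⊖ a j)) →
    ∀ i j → ⟨ b i ⊖ b o , b j ⊖ b o ⟩ ≈ ⟨ a i ⊖ a o , a j ⊖ a o ⟩
  distance-determines-gram a b o iso i j = begin
    ⟨ b i ⊖ b o , b j ⊖ b o ⟩
      ≈⟨ polarization (b i) (b j) (b o) ⟩
    ½# * (sqNorm (b i ⊖ b o) + sqNorm (b j ⊖ b o) - sqNorm (b i ⊖ b j))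
      ≈⟨ *-congˡ (+-cong (+-cong (iso i o) (iso j o)) (-‿cong (iso i j))) ⟩
    ½# * (sqNorm (a i ⊖ a o) + sqNorm (a j ⊖ a o) - sqNorm (a i ⊖ a j))
      ≈⟨ polarization (a i) (a j) (a o) ⟨
    ⟨ a i ⊖ a o , a j ⊖ a o ⟩ ∎

  sqNorm-cong : ∀ {n} {x y : Space n} → (∀ i → x i ≈ y i) → sqNorm x ≈ sqNorm y
  sqNorm-cong x≈y = ⟨⟩-cong x≈y x≈y

  -- The circumcentre in the affine span

  module Circumcentre {m n} (a : Fin m → Space n) (o : Fin m) (c : Space n) {R : Carrier}
    (sphere : ∀ i → sqNorm (a i ⊖ c) ≈ R) where

    u : Fin m → Space n
    u i = a i ⊖ a o

    w : Space n
    w = c ⊖ a o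

    μ : Space m
    μ = proj₁ (projection u w)

    y : Space n
    y = combination μ u

    ⟨y,u⟩≈⟨w,u⟩ : ∀ i → ⟨ y , u i ⟩ ≈ ⟨ w , u i ⟩
    ⟨y,u⟩≈⟨w,u⟩ i = begin
      ⟨ y , u i ⟩                                ≈⟨ +-identityˡ _ ⟨
      0# + ⟨ y , u i ⟩                           ≈⟨ +-congʳ (proj₂ (projection u w) i) ⟨
      ⟨ w ⊖ y , u i ⟩ + ⟨ y , u i ⟩              ≈⟨ +-congʳ (⟨⊖⟩ w y (u i)) ⟩
      ⟨ w , u i ⟩ - ⟨ y , u i ⟩ + ⟨ y , u i ⟩    ≈⟨ solve 2 (λ a b → a :- b :+ b := a) refl _ _ ⟩
      ⟨ w , u i ⟩                                ∎

    -- Both `sqNorm (u i ⊖ w)` and `sqNorm w` equal `R`, being squared distances from `c` to `a i`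
    -- and `a o`. Expanding the first gives the claim for `w`, and projection preserves inner
    -- products with `u i`.
    sqNorm-u : ∀ i → sqNorm (u i) ≈ ⟨ y , u i ⟩ + ⟨ y , u i ⟩
    sqNorm-u i = begin
      sqNorm (u i)
        ≈⟨ solve 3 (λ n q w → n := (n :- (q :+ q) :+ w) :- w :+ (q :+ q)) refl _ ⟨ w , u i ⟩ (sqNorm w) ⟩
      sqNorm (u i) - (⟨ w , u i ⟩ + ⟨ w , u i ⟩) + sqNorm w - sqNorm w + (⟨ w , u i ⟩ + ⟨ w , u i ⟩)
        ≈⟨ +-congʳ (+-cong (trans (sym (sqNorm-⊖ (u i) w)) (trans (sqNorm-cong (λ k →
             solve 3 (λ a o c → a :- o :- (c :- o) := a :- c) refl (a i k) (a o k) (c k))) (sphere i)))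
             (-‿cong (trans (sqNorm-cong-neg (λ k → solve 2 (λ o c → c :- o := :- (o :- c)) refl (a o k) (c k))) (sphere o)))) ⟩
      R - R + (⟨ w , u i ⟩ + ⟨ w , u i ⟩)
        ≈⟨ trans (+-congʳ (-‿inverseʳ R)) (+-identityˡ _) ⟩
      ⟨ w , u i ⟩ + ⟨ w , u i ⟩
        ≈⟨ +-cong (⟨y,u⟩≈⟨w,u⟩ i) (⟨y,u⟩≈⟨w,u⟩ i) ⟨
      ⟨ y , u i ⟩ + ⟨ y , u i ⟩ ∎
      where
      sqNorm-cong-neg : ∀ {n} {x y : Space n} → (∀ i → x i ≈ - y i) → sqNorm x ≈ sqNorm y
      sqNorm-cong-neg x≈-y = sum-cong-≋ (λ i → trans (*-cong (x≈-y i) (x≈-y i))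
        (solve 1 (λ y → :- y :* :- y := y :* y) refl _))

    y-sphere : ∀ i → sqNorm (a i ⊖ (a o ⊕ y)) ≈ sqNorm y
    y-sphere i = begin
      sqNorm (a i ⊖ (a o ⊕ y))
        ≈⟨ sqNorm-cong (λ k → solve 3 (λ a o y → a :- (o :+ y) := a :- o :- y) refl (a i k) (a o k) (y k)) ⟩
      sqNorm (u i ⊖ y)
        ≈⟨ sqNorm-⊖ (u i) y ⟩
      sqNorm (u i) - (⟨ y , u i ⟩ + ⟨ y , u i ⟩) + sqNorm y
        ≈⟨ +-congʳ (trans (+-congʳ (sqNorm-u i)) (-‿inverseʳ _)) ⟩
      0# + sqNorm y
        ≈⟨ +-identityˡ _ ⟩
      sqNorm y ∎

  -- Colouring by the squared norm

  -- `R` and `B` stand for ρ² and r². The colour is a function on the field rather than on a space,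
  -- so one map serves every `D`.
  squaredAvoidingColouring : ∀ {m n} (a : Fin m → Space n) → Fin m → (c : Space n) {R B : Carrier} →
    (∀ i → sqNorm (a i ⊖ c) ≈ R) →
    (∀ c′ {R′} → (∀ i → sqNorm (a i ⊖ c′) ≈ R′) → R ≤ R′) →
    ¬ R ≤ B → ∃[ k ] Σ[ colour ∈ (Carrier → Fin (suc k)) ]
      (∀ {x y} → x ≈ y → colour x ≡ colour y) ×
      (∀ {D} (b : Fin m → Space D) → (∀ i j → sqNorm (b i ⊖ b j) ≈ sqNorm (a i ⊖ a j)) →
        (∀ i → sqNorm (b i) ≤ B) → ¬ (∀ i j → colour (sqNorm (b i)) ≡ colour (sqNorm (b j))))
  squaredAvoidingColouring {m} a o c {R} {B} sphere minimal R≰B = k , bucket k ε , bucket-cong k ε , avoids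
    where
    open Circumcentre a o c sphere

    W = sum (λ i → weight (μ i))
    -- Doubled, because `centre-bound` compares doubled squared norms.
    gap = (R - B) + (R - B)

    0≤R-B : 0# ≤ R - B
    0≤R-B = x≤y⇒0≤y-x (≰⇒≥ R≰B)

    0≤gap : 0# ≤ gap
    0≤gap = 0≤x+y 0≤R-B 0≤R-B

    gap≰0 : ¬ gap ≤ 0#
    gap≰0 gap≤0 = R≰B (≤-shift
      (trans (+-identityˡ _) (solve 2 (λ R B → :- (R :- B) := B :- R) refl R B))
      (≤-trans (x≤x+y (R - B) 0≤R-B) gap≤0))

    -- Nontriviality is not a field axiom here; it follows from the existence of an element that is
    -- not below zero.
    1≰0 : ¬ 1# ≤ 0#
    1≰0 1≤0 = gap≰0 (≤-respˡ-≈ (*-identityʳ gap) (≤-respʳ-≈ (zeroʳ gap) (*-monoʳ-≤ 0≤gap 1≤0)))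

    0≤W : 0# ≤ W
    0≤W = 0≤sum (λ i → 0≤x+y (≤-respʳ-≈ (sym 1-homo) 0≤1) (0≤x*x (μ i)))

    W+1≉0 : ¬ W + 1# ≈ 0#
    W+1≉0 W+1≈0 = 1≰0 (≤-respʳ-≈ W+1≈0 (x≤y+x 1# 0≤W))

    η = proj₁ (inverse (W + 1#) W+1≉0)
    η*[W+1]≈1 = proj₂ (inverse (W + 1#) W+1≉0)

    -- The added `1#` in the denominator makes `W * ε` fall short of `gap` by exactly `ε`, which
    -- supplies the strict contradiction.
    ε = gap * η

    [W+1]ε≈gap : W * ε + ε ≈ gap
    [W+1]ε≈gap = begin
      W * (gap * η) + gap * η         ≈⟨ +-congˡ (*-congˡ (*-identityˡ η)) ⟨
      W * (gap * η) + gap * (1# * η)  ≈⟨ solve 4 (λ w g n o → w :* (g :* n) :+ g :* (o :* n) := g :* (n :* (w :+ o))) refl W gap η 1# ⟩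
      gap * (η * (W + 1#))            ≈⟨ *-congˡ η*[W+1]≈1 ⟩
      gap * 1#                        ≈⟨ *-identityʳ gap ⟩
      gap                             ∎

    0≤ε : 0# ≤ ε
    0≤ε = 0≤x*y 0≤gap (inverse-nonNeg (≤-trans 0≤1 (x≤y+x 1# 0≤W)) η*[W+1]≈1)

    ε≰0 : ¬ ε ≤ 0#
    ε≰0 ε≤0 = gap≰0 (≤-reflexive (begin
      gap           ≈⟨ [W+1]ε≈gap ⟨
      W * ε + ε     ≈⟨ +-cong (*-congˡ ε≈0) ε≈0 ⟩
      W * 0# + 0#   ≈⟨ trans (+-identityʳ _) (zeroʳ W) ⟩
      0#            ∎))
      where ε≈0 = antisym ε≤0 0≤ε

    k = proj₁ (archimedean′ B 0≤ε (ε≰0 ∘ ≤-reflexive))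

    -- `bucket k` has `suc k` buckets, so the bound by `k ⋆ ε` is relaxed to the range that
    -- `bucket-close` expects.
    B≤[1+k]ε : B ≤ suc k ⋆ ε
    B≤[1+k]ε = ≤-trans (proj₂ (archimedean′ B 0≤ε (ε≰0 ∘ ≤-reflexive))) (x≤y+x _ 0≤ε)

    avoids : ∀ {D} (b : Fin m → Space D) → (∀ i j → sqNorm (b i ⊖ b j) ≈ sqNorm (a i ⊖ a j)) →
      (∀ i → sqNorm (b i) ≤ B) → ¬ (∀ i j → bucket k ε (sqNorm (b i)) ≡ bucket k ε (sqNorm (b j)))
    -- The chain `R + R ≤ W * ε + (B + B)` says `gap ≤ W * ε`, that is, `ε ≤ 0#`.
    avoids b isometric bounded monochromatic = ε≰0 (≤-shift
      (begin
        W * ε + (B + B) - (R + R)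
          ≈⟨ solve 3 (λ w r b → w :+ (b :+ b) :- (r :+ r) := w :- ((r :- b) :+ (r :- b))) refl (W * ε) R B ⟩
        W * ε - gap
          ≈⟨ +-congˡ (-‿cong [W+1]ε≈gap) ⟨
        W * ε - (W * ε + ε)
          ≈⟨ solve 2 (λ w e → w :- (w :+ e) := :- e) refl (W * ε) ε ⟩
        - ε
          ≈⟨ +-identityˡ _ ⟨
        0# - ε ∎)
      (≤-trans (+-mono-≤ R≤Ny R≤Ny) (≤-trans
        (centre-bound μ u (λ i → b i ⊖ b o) (b o)
          (distance-determines-gram a b o isometric) sqNorm-u
          (λ i → ≤-respˡ-≈ (sym (shift i)) (close i o))
          (λ i → ≤-respʳ-≈ (+-congʳ (sym (shift i))) (close o i)))
        (+-mono-≤ ≤-refl (+-mono-≤ (bounded o) (bounded o))))))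
      where
      R≤Ny : R ≤ sqNorm y
      R≤Ny = minimal (a o ⊕ y) y-sphere

      shift : ∀ i → sqNorm ((b i ⊖ b o) ⊕ b o) ≈ sqNorm (b i)
      shift i = sqNorm-cong (λ k → solve 2 (λ x o → x :- o :+ o := x) refl (b i k) (b o k))

      close : ∀ i j → sqNorm (b i) ≤ sqNorm (b j) + ε
      close i j = bucket-close k ε (0≤sqNorm (b i)) (0≤sqNorm (b j))
        (≤-trans (bounded i) B≤[1+k]ε) (≤-trans (bounded j) B≤[1+k]ε) (monochromatic i j)

  ∥_∥ : ∀ {n} → Space n → Carrier
  ∥ x ∥ = √ sqNorm x

  ∥∥-cong : ∀ {n} {x y : Space n} → (∀ i → x i ≈ y i) → ∥ x ∥ ≈ ∥ y ∥
  ∥∥-cong x≈y = √-cong (sqNorm-cong x≈y)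

  ∥⊖∥-congʳ : ∀ {n} {x y z : Space n} → (∀ i → x i ≈ y i) → ∥ x ⊖ z ∥ ≈ ∥ y ⊖ z ∥
  ∥⊖∥-congʳ x≈y = ∥∥-cong (λ i → +-congʳ (x≈y i))

  sqNorm≈∥∥*∥∥ : ∀ {n} (x : Space n) → sqNorm x ≈ ∥ x ∥ * ∥ x ∥
  sqNorm≈∥∥*∥∥ x = sym (√x*√x≈x (0≤sqNorm x))

  avoidingColouring : ∀ {m n} (a : Fin m → Space n) → Fin m → (c : Space n) {ρ r : Carrier} →
    0# ≤ ρ → (∀ i → ∥ a i ⊖ c ∥ ≈ ρ) →
    (∀ ρ′ c′ → 0# ≤ ρ′ → (∀ i → ∥ a i ⊖ c′ ∥ ≈ ρ′) → ρ ≤ ρ′) →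
    0# ≤ r → ¬ ρ ≤ r → ∃[ k ] Σ[ colour ∈ (∀ {D} → Space D → Fin (suc k)) ]
      (∀ {D} {x y : Space D} → (∀ i → x i ≈ y i) → colour x ≡ colour y) ×
      (∀ {D} (b : Fin m → Space D) → (∀ i j → ∥ b i ⊖ b j ∥ ≈ ∥ a i ⊖ a j ∥) →
        (∀ i → ∥ b i ∥ ≤ r) → ¬ (∀ i j → colour (b i) ≡ colour (b j)))
  avoidingColouring a o c {ρ} {r} 0≤ρ sphere minimal 0≤r ρ≰r =
    let k , colour , colour-cong , avoids = squaredAvoidingColouring a o c {ρ * ρ} {r * r}
          (λ i → trans (sqNorm≈∥∥*∥∥ (a i ⊖ c)) (*-cong (sphere i) (sphere i)))
          minimal²
          (λ ρ²≤r² → ρ≰r (square-cancel-≤ 0≤r ρ²≤r²))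
    in k , (λ x → colour (sqNorm x)) , (λ x≈y → colour-cong (sqNorm-cong x≈y)) , λ b isometric bounded → avoids b
      (λ i j → trans (sqNorm≈∥∥*∥∥ (b i ⊖ b j)) (trans (*-cong (isometric i j) (isometric i j))
        (sym (sqNorm≈∥∥*∥∥ (a i ⊖ a j)))))
      (λ i → ≤-respˡ-≈ (sym (sqNorm≈∥∥*∥∥ (b i))) (*-mono-square-≤ (0≤√ (sqNorm (b i))) (bounded i)))
    where
    minimal² : ∀ c′ {R′} → (∀ i → sqNorm (a i ⊖ c′) ≈ R′) → ρ * ρ ≤ R′
    -- The point `a o` shows that `R′` is a squared norm, hence non-negative, so `√ R′` is a genuine
    -- radius.
    minimal² c′ {R′} sphere′ = ≤-respʳ-≈ (√x*√x≈x (≤-respʳ-≈ (sphere′ o) (0≤sqNorm (a o ⊖ c′))))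
      (*-mono-square-≤ 0≤ρ (minimal (√ R′) c′ (0≤√ R′) (λ i → √-cong (sphere′ i))))

open import Defs
open ℚ-Lemmas
open ℝ-Lemmas using (bounded)
open Root-Lemmas using (0<ι; ι-antitone; frac-suc; q≤∣↥q∣; archimedean)

-- Cauchy reals: ring laws, order, inverses and square roots

≤-shift : ∀ {p q r s} → q ℚ.- p ≡ s ℚ.- r → p ℚ.≤ q → r ℚ.≤ s
≤-shift {p} {q} {r} {s} eq p≤q = ≡.subst₂ ℚ._≤_
  (solve 2 (λ p r → p :+ (r :- p) := r) ≡.refl p r)
  (≡.trans (solve 3 (λ p q r → q :+ (r :- p) := q :- p :+ r) ≡.refl p q r)
    (≡.trans (≡.cong (ℚ._+ r) eq) (solve 2 (λ r s → s :- r :+ r := s) ≡.refl r s)))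
  (ℚ.+-monoˡ-≤ (r ℚ.- p) p≤q)
  where open +-*-Solver

p≤p+q : ∀ p {q} → 0ℚ ℚ.≤ q → p ℚ.≤ p ℚ.+ q
p≤p+q p {q} 0≤q = ≡.subst (ℚ._≤ p ℚ.+ q) (ℚ.+-identityʳ p) (ℚ.+-monoʳ-≤ p 0≤q)

Eventually : (ℕ → Set) → Set
Eventually P = ∃[ N ] (∀ n → N ℕ.≤ n → P n)

eventually-map : ∀ {P Q : ℕ → Set} → (∀ n → P n → Q n) → Eventually P → Eventually Q
eventually-map f (N , p) = N , λ n N≤n → f n (p n N≤n)

eventually-map₂ : ∀ {P Q R : ℕ → Set} → (∀ n → P n → Q n → R n) →
                  Eventually P → Eventually Q → Eventually R
eventually-map₂ f (M , p) (N , q) = M ℕ.⊔ N , λ n ≤n →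
  f n (p n (ℕ.m⊔n≤o⇒m≤o M N ≤n)) (q n (ℕ.m⊔n≤o⇒n≤o M N ≤n))

-- The operations act termwise, so this carries each ring law over from ℚ.
pointwise : ∀ {x y} → (∀ n → seq x n ≡ seq y n) → x ≈ y
pointwise {x} {y} x≡y ε 0<ε = 0 , λ n _ → ≡.subst (ℚ._< ε)
  (≡.sym (≡.trans (≡.cong (λ p → ∣ p - seq y n ∣) (x≡y n)) (∣p-p∣≡0 (seq y n)))) 0<ε

const : ℚ → ℝ
const p = mkℝ (λ _ → p) λ ε 0<ε → 0 , λ _ _ _ _ → ≡.subst (ℚ._< ε) (≡.sym (∣p-p∣≡0 p)) 0<ε

+-cong : ∀ {x y u v} → x ≈ y → u ≈ v → x + u ≈ y + v
+-cong {x} {y} {u} {v} x≈y u≈v ε 0<ε = eventually-map₂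
  (λ n h k → ℚ.≤-<-trans
    (≡.subst (ℚ._≤ ∣ seq x n - seq y n ∣ ℚ.+ ∣ seq u n - seq v n ∣)
      (≡.cong ℚ.∣_∣ (solve 4 (λ x y u v → x :- y :+ (u :- v) := x :+ u :- (y :+ v)) ≡.refl
        (seq x n) (seq y n) (seq u n) (seq v n)))
      (ℚ.∣p+q∣≤∣p∣+∣q∣ (seq x n ℚ.- seq y n) (seq u n ℚ.- seq v n)))
    (≡.subst (_ ℚ.<_) (half+half ε) (ℚ.+-mono-< h k)))
  (x≈y (half ε) (0<half 0<ε)) (u≈v (half ε) (0<half 0<ε))
  where open +-*-Solver

-‿cong : ∀ {x y} → x ≈ y → - x ≈ - y
-‿cong {x} {y} x≈y ε 0<ε = eventually-map
  (λ n → ≡.subst (ℚ._< ε) (≡.trans (≡.sym (ℚ.∣-p∣≡∣p∣ (seq x n ℚ.- seq y n)))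
    (≡.cong ℚ.∣_∣ (solve 2 (λ x y → :- (x :- y) := :- x :- :- y) ≡.refl (seq x n) (seq y n)))))
  (x≈y ε 0<ε)
  where open +-*-Solver

*-congʳ : ∀ {x y} z → x ≈ y → x * z ≈ y * z
*-congʳ {x} {y} z x≈y ε 0<ε =
  let B , 0<B , bound = bounded z
      δ , 0<δ , B*δ≡  = scale (half ε) B (0<half 0<ε) 0<B
  in eventually-map₂ (λ n z≤B h → ℚ.≤-<-trans
       (≡.subst₂ ℚ._≤_
         (≡.trans (≡.sym (ℚ.∣p*q∣≡∣p∣*∣q∣ (seq z n) (seq x n ℚ.- seq y n)))
           (≡.cong ℚ.∣_∣ (solve 3 (λ x y z → z :* (x :- y) := x :* z :- y :* z)
             ≡.refl (seq x n) (seq y n) (seq z n))))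
         B*δ≡
         (*-mono-≤ (ℚ.0≤∣p∣ (seq z n)) (ℚ.<⇒≤ 0<δ) z≤B (ℚ.<⇒≤ h)))
       (half< 0<ε)) bound (x≈y δ 0<δ)
  where open +-*-Solver

open Setoid ≈-setoid using () renaming (refl to ≈-refl; sym to ≈-sym; trans to ≈-trans)

*-cong : ∀ {x y u v} → x ≈ y → u ≈ v → x * u ≈ y * v
*-cong {x} {y} {u} {v} x≈y u≈v = ≈-trans {x * u} {y * u} {y * v} (*-congʳ {x} {y} u x≈y)
  (≈-trans {y * u} {u * y} {y * v} (pointwise {y * u} {u * y} λ n → ℚ.*-comm (seq y n) (seq u n))
    (≈-trans {u * y} {v * y} {y * v} (*-congʳ {u} {v} y u≈v)
      (pointwise {v * y} {y * v} λ n → ℚ.*-comm (seq v n) (seq y n))))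

+-*-isCommutativeRing : IsCommutativeRing _≈_ _+_ _*_ -_ 0ℝ (const 1ℚ)
+-*-isCommutativeRing = record
  { isRing = record
    { +-isAbelianGroup = record
      { isGroup = record
        { isMonoid = record
          { isSemigroup = record
            { isMagma = record
              { isEquivalence = Setoid.isEquivalence ≈-setoid
              ; ∙-cong = λ {x} {y} {u} {v} → +-cong {x} {y} {u} {v}
              }
            ; assoc = λ x y z → pointwise {x + y + z} {x + (y + z)} λ n → ℚ.+-assoc (seq x n) (seq y n) (seq z n)
            }
          ; identity = (λ x → pointwise {0ℝ + x} {x} λ n → ℚ.+-identityˡ (seq x n))
                     , (λ x → pointwise {x + 0ℝ} {x} λ n → ℚ.+-identityʳ (seq x n))
          }
        ; inverse = (λ x → pointwise {(- x) + x} {0ℝ} λ n → ℚ.+-inverseˡ (seq x n))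
                  , (λ x → pointwise {x - x} {0ℝ} λ n → ℚ.+-inverseʳ (seq x n))
        ; ⁻¹-cong = λ {x} {y} → -‿cong {x} {y}
        }
      ; comm = λ x y → pointwise {x + y} {y + x} λ n → ℚ.+-comm (seq x n) (seq y n)
      }
    ; *-cong = λ {x} {y} {u} {v} → *-cong {x} {y} {u} {v}
    ; *-assoc = λ x y z → pointwise {x * y * z} {x * (y * z)} λ n → ℚ.*-assoc (seq x n) (seq y n) (seq z n)
    ; *-identity = (λ x → pointwise {const 1ℚ * x} {x} λ n → ℚ.*-identityˡ (seq x n))
                 , (λ x → pointwise {x * const 1ℚ} {x} λ n → ℚ.*-identityʳ (seq x n))
    ; distrib = (λ x y z → pointwise {x * (y + z)} {x * y + x * z} λ n → ℚ.*-distribˡ-+ (seq x n) (seq y n) (seq z n))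
              , (λ x y z → pointwise {(y + z) * x} {y * x + z * x} λ n → ℚ.*-distribʳ-+ (seq x n) (seq y n) (seq z n))
    }
  ; *-comm = λ x y → pointwise {x * y} {y * x} λ n → ℚ.*-comm (seq x n) (seq y n)
  }

open IsCommutativeRing +-*-isCommutativeRing using (zeroˡ; zeroʳ)

-- Recovers positive information from a negated inequality without excluded middle. Past a Cauchy
-- index `N` for `x - y`, one rational comparison of `z N` with `half ε` decides: if `z N` is
-- larger, then `y < x` with margin `z N - half ε`.
≤⇒≤+ε : ∀ {x y} → x ≤ y → ∀ ε → 0ℚ ℚ.< ε → Eventually λ n → seq x n ℚ.≤ seq y n ℚ.+ ε
≤⇒≤+ε {x} {y} x≤y ε 0<ε =
  let N , close = cauchy (x - y) (half ε) (0<half 0<ε)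
  in N , bound N close (z N ℚ.≤? half ε)
  where
  open +-*-Solver

  z : ℕ → ℚ
  z n = seq x n ℚ.- seq y n

  shift₁ : ∀ p q → p ℚ.- q ℚ.≤ ε → p ℚ.≤ q ℚ.+ ε
  shift₁ p q = ≤-shift (solve 3 (λ p q ε → ε :- (p :- q) := q :+ ε :- p) ≡.refl p q ε)

  shift₂ : ∀ p q r η → r ℚ.≤ p ℚ.- q ℚ.+ η → q ℚ.+ (r ℚ.- η) ℚ.≤ p
  shift₂ p q r η =
    ≤-shift (solve 4 (λ p q r η → p :- q :+ η :- r := p :- (q :+ (r :- η))) ≡.refl p q r η)

  bound : ∀ N → (∀ m n → N ℕ.≤ m → N ℕ.≤ n → ∣ z m - z n ∣ ℚ.< half ε) → Dec (z N ℚ.≤ half ε) →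
          ∀ n → N ℕ.≤ n → seq x n ℚ.≤ seq y n ℚ.+ ε
  bound N close (yes z≤ε/2) n N≤n = shift₁ (seq x n) (seq y n)
    (ℚ.≤-trans (ℚ.<⇒≤ (∣p-q∣<ε⇒p<q+ε (z n) (z N) (close n N N≤n ℕ.≤-refl)))
      (≡.subst (z N ℚ.+ half ε ℚ.≤_) (half+half ε) (ℚ.+-monoˡ-≤ (half ε) z≤ε/2)))
  bound N close (no z≰ε/2) = contradiction
    ( z N ℚ.- half ε
    , ≡.subst (ℚ._< z N ℚ.- half ε) (ℚ.+-inverseʳ (half ε)) (ℚ.+-monoˡ-< (ℚ.- half ε) (ℚ.≰⇒> z≰ε/2))
    , N , λ n N≤n → shift₂ (seq x n) (seq y n) (z N) (half ε)
        (ℚ.<⇒≤ (∣p-q∣<ε⇒p<q+ε (z N) (z n) (close N n ℕ.≤-refl N≤n))))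
    x≤y

≤+ε⇒≤ : ∀ {x y} → (∀ ε → 0ℚ ℚ.< ε → Eventually λ n → seq x n ℚ.≤ seq y n ℚ.+ ε) → x ≤ y
≤+ε⇒≤ {x} {y} h (ε , 0<ε , M , y+ε≤x) with h (half ε) (0<half 0<ε)
... | N , x≤y+ε/2 = ℚ.<-irrefl ≡.refl (ℚ.<-≤-trans (half< 0<ε) (≤-shift
    (solve 3 (λ y ε η → y :+ η :- (y :+ ε) := η :- ε) ≡.refl (seq y (M ℕ.⊔ N)) ε (half ε))
    (ℚ.≤-trans (y+ε≤x _ (ℕ.m≤m⊔n M N)) (x≤y+ε/2 _ (ℕ.m≤n⊔m M N)))))
  where open +-*-Solver

≤-reflexive : ∀ {x y} → x ≈ y → x ≤ y
≤-reflexive {x} {y} x≈y = ≤+ε⇒≤ {x} {y} λ ε 0<ε → eventually-map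
  (λ n h → ℚ.<⇒≤ (∣p-q∣<ε⇒p<q+ε (seq x n) (seq y n) h)) (x≈y ε 0<ε)

≤-trans : ∀ {x y z} → x ≤ y → y ≤ z → x ≤ z
≤-trans {x} {y} {z} x≤y y≤z = ≤+ε⇒≤ {x} {z} λ ε 0<ε → eventually-map₂
  (λ n h k → ℚ.≤-trans h (≡.subst (seq y n ℚ.+ half ε ℚ.≤_)
    (≡.trans (ℚ.+-assoc (seq z n) (half ε) (half ε)) (≡.cong (seq z n ℚ.+_) (half+half ε)))
    (ℚ.+-monoˡ-≤ (half ε) k)))
  (≤⇒≤+ε {x} {y} x≤y (half ε) (0<half 0<ε)) (≤⇒≤+ε {y} {z} y≤z (half ε) (0<half 0<ε))

≤-antisym : ∀ {x y} → x ≤ y → y ≤ x → x ≈ y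
≤-antisym {x} {y} x≤y y≤x ε 0<ε = eventually-map₂
  (λ n h k → ℚ.≤-<-trans (∣p-q∣≤ε h k) (half< 0<ε))
  (≤⇒≤+ε {x} {y} x≤y (half ε) (0<half 0<ε)) (≤⇒≤+ε {y} {x} y≤x (half ε) (0<half 0<ε))

<⇒≤ : ∀ {x y} → x < y → x ≤ y
<⇒≤ {x} {y} (δ , 0<δ , x+δ≤y) = ≤+ε⇒≤ {x} {y} λ ε 0<ε → eventually-map
  (λ n h → ℚ.≤-trans (ℚ.≤-trans (p≤p+q (seq x n) (ℚ.<⇒≤ 0<δ)) h) (p≤p+q (seq y n) (ℚ.<⇒≤ 0<ε))) x+δ≤y

+-monoˡ-≤ : ∀ z {x y} → x ≤ y → x + z ≤ y + z
+-monoˡ-≤ z {x} {y} x≤y (ε , 0<ε , h) = x≤y (ε , 0<ε , eventually-map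
  (λ n → ≤-shift (solve 4 (λ x y z ε → x :+ z :- (y :+ z :+ ε) := x :- (y :+ ε)) ≡.refl
    (seq x n) (seq y n) (seq z n) ε)) h)
  where open +-*-Solver

0<x*y : ∀ {x y} → 0ℝ < x → 0ℝ < y → 0ℝ < x * y
0<x*y {x} {y} (δ , 0<δ , δ≤x) (ε , 0<ε , ε≤y) = δ ℚ.* ε , 0<p*q 0<δ 0<ε , eventually-map₂
  (λ n h k →
    let δ≤xₙ = ≡.subst (ℚ._≤ seq x n) (ℚ.+-identityˡ δ) h
        ε≤yₙ = ≡.subst (ℚ._≤ seq y n) (ℚ.+-identityˡ ε) k
    in ≡.subst (ℚ._≤ seq x n ℚ.* seq y n) (≡.sym (ℚ.+-identityˡ (δ ℚ.* ε)))
         (*-mono-≤ (ℚ.<⇒≤ 0<δ) (ℚ.≤-trans (ℚ.<⇒≤ 0<ε) ε≤yₙ) δ≤xₙ ε≤yₙ))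
  δ≤x ε≤y

inverse-positive : ∀ x → 0ℝ < x → ∃[ y ] y * x ≈ const 1ℚ
inverse-positive x (δ , 0<δ , N , δ≤x) = x⁻¹ , λ ε 0<ε → N , λ n N≤n →
  ≡.subst (ℚ._< ε) (≡.sym (≡.trans (≡.cong ∣_- 1ℚ ∣ (inverseˡ n N≤n)) (∣p-p∣≡0 1ℚ))) 0<ε
  where
  open +-*-Solver
  -- Capping the index from below by `N` keeps every term at least `δ`, so all reciprocals exist;
  -- eventually nothing changes.
  X : ℕ → ℚ
  X n = seq x (n ℕ.⊔ N)

  δ≤X : ∀ n → δ ℚ.≤ X n
  δ≤X n = ≡.subst (ℚ._≤ X n) (ℚ.+-identityˡ δ) (δ≤x _ (ℕ.m≤n⊔m n N))

  instance
    X-nonZero : ∀ {n} → ℚ.NonZero (X n)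
    X-nonZero {n} = ℚ.pos⇒nonZero (X n) {{ℚ.positive (ℚ.<-≤-trans 0<δ (δ≤X n))}}

  Y : ℕ → ℚ
  Y n = ℚ.1/ X n

  inverseˡ : ∀ n → N ℕ.≤ n → Y n ℚ.* seq x n ≡ 1ℚ
  inverseˡ n N≤n = ≡.trans (≡.cong (λ k → Y n ℚ.* seq x k) (≡.sym (ℕ.m≥n⇒m⊔n≡m N≤n))) (ℚ.*-inverseˡ (X n))

  isCauchy : IsCauchy Y
  isCauchy ε 0<ε =
    -- Since 1/Xₘ - 1/Xₙ = (Xₙ - Xₘ)/(XₘXₙ) and XₘXₙ ≥ δ², closeness δ²ε of the terms gives ε for
    -- the reciprocals.
    let M , close = cauchy x (δ ℚ.* δ ℚ.* ε) (0<p*q (0<p*q 0<δ 0<δ) 0<ε)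
    in M , λ m n M≤m M≤n → ℚ.*-cancelˡ-<-nonNeg (δ ℚ.* δ) {{ℚ.nonNegative 0≤δ²}} (ℚ.≤-<-trans
         (ℚ.*-monoʳ-≤-nonNeg ∣ Y m - Y n ∣ {{ℚ.nonNegative (ℚ.0≤∣p∣ (Y m ℚ.- Y n))}} (δ²≤∣XX∣ m n))
         (≡.subst (ℚ._< δ ℚ.* δ ℚ.* ε)
           (≡.trans (≡.cong ℚ.∣_∣ (clear m n)) (ℚ.∣p*q∣≡∣p∣*∣q∣ (X m ℚ.* X n) (Y m ℚ.- Y n)))
           (close (n ℕ.⊔ N) (m ℕ.⊔ N) (ℕ.m≤n⇒m≤n⊔o N M≤n) (ℕ.m≤n⇒m≤n⊔o N M≤m))))
    where
    0≤δ = ℚ.<⇒≤ 0<δ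
    0≤δ² = 0≤p*q 0≤δ 0≤δ
    δ²≤∣XX∣ : ∀ m n → δ ℚ.* δ ℚ.≤ ℚ.∣ X m ℚ.* X n ∣
    δ²≤∣XX∣ m n = ℚ.≤-trans (*-mono-≤ 0≤δ (ℚ.≤-trans 0≤δ (δ≤X n)) (δ≤X m) (δ≤X n)) (p≤∣p∣ (X m ℚ.* X n))
    clear : ∀ m n → X n ℚ.- X m ≡ X m ℚ.* X n ℚ.* (Y m ℚ.- Y n)
    clear m n = ≡.sym (≡.trans
      (solve 4 (λ a b c d → a :* b :* (c :- d) := b :* (c :* a) :- a :* (d :* b)) ≡.refl (X m) (X n) (Y m) (Y n))
      (≡.cong₂ ℚ._-_ (≡.trans (≡.cong (X n ℚ.*_) (ℚ.*-inverseˡ (X m))) (ℚ.*-identityʳ (X n)))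
                     (≡.trans (≡.cong (X m ℚ.*_) (ℚ.*-inverseˡ (X n))) (ℚ.*-identityʳ (X m)))))

  x⁻¹ : ℝ
  x⁻¹ = mkℝ Y isCauchy

0<-x : ∀ {x} → x < 0ℝ → 0ℝ < - x
0<-x {x} (δ , 0<δ , x+δ≤0) = δ , 0<δ , eventually-map
  (λ n → ≤-shift (solve 2 (λ x δ → con 0ℚ :- (x :+ δ) := :- x :- (con 0ℚ :+ δ)) ≡.refl (seq x n) δ)) x+δ≤0
  where open +-*-Solver

inverse-negative : ∀ x → x < 0ℝ → ∃[ y ] y * x ≈ const 1ℚ
inverse-negative x x<0 =
  let y , y*-x≈1 = inverse-positive (- x) (0<-x {x} x<0)
  in - y , ≈-trans {(- y) * x} {y * (- x)} {const 1ℚ}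
       (pointwise {(- y) * x} {y * (- x)} λ n → -y*x≡y*-x (seq x n) (seq y n)) y*-x≈1
  where
  open +-*-Solver
  -y*x≡y*-x : ∀ p q → (ℚ.- q) ℚ.* p ≡ q ℚ.* (ℚ.- p)
  -y*x≡y*-x = solve 2 (λ p q → :- q :* p := q :* :- p) ≡.refl

√-cong : ∀ {x y} → x ≈ y → √ x ≈ √ y
√-cong {x} {y} x≈y ε 0<ε = eventually-map₂
  (λ n h ι≤δ → close (seq x n) (seq y n) n ι≤δ h)
  (x≈y (sq δ) (0<p*q 0<δ 0<δ)) (archimedean δ 0<δ)
  where
  -- `approx√-close` loses `δ + δ`, which is then `half ε`, strictly below `ε`.
  δ = half (half ε)
  0<δ = 0<half (0<half 0<ε)

  close : ∀ p q n → ι n ℚ.≤ δ → ∣ p - q ∣ ℚ.< sq δ → ∣ approx√ p n - approx√ q n ∣ ℚ.< ε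
  close p q n ι≤δ h = ℚ.≤-<-trans
    (∣p-q∣≤ε {approx√ p n} {approx√ q n}
      (approx√-close p q n n 0<δ ι≤δ (∣p-q∣<ε⇒p<q+ε p q h))
      (approx√-close q p n n 0<δ ι≤δ
        (∣p-q∣<ε⇒p<q+ε q p (≡.subst (ℚ._< sq δ) (∣p-q∣≡∣q-p∣ p q) h))))
    (≡.subst (ℚ._< ε) (≡.sym (half+half (half ε))) (half< 0<ε))

0≤√ : ∀ x → 0ℝ ≤ √ x
0≤√ x = ≤+ε⇒≤ {0ℝ} {√ x} λ ε 0<ε → 0 , λ n _ → ℚ.+-mono-≤ (approx√-nonNeg (seq x n) n) (ℚ.<⇒≤ 0<ε)

-- Individual terms of `x` may be negative. The approximate root is then `0ℚ`, and `0ℝ ≤ x` bounds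
-- such terms below by `-ε` eventually.
√x*√x≤x : ∀ {x} → 0ℝ ≤ x → √ x * √ x ≤ x
√x*√x≤x {x} 0≤x = ≤+ε⇒≤ {√ x * √ x} {x} λ ε 0<ε → eventually-map
  (λ n → lower (seq x n) (approx√ (seq x n) n) 0<ε (approx√-lower (seq x n) n))
  (≤⇒≤+ε {0ℝ} {x} 0≤x ε 0<ε)
  where
  lower : ∀ p a {ε} → 0ℚ ℚ.< ε → a ≡ 0ℚ ⊎ sq a ℚ.≤ p → 0ℚ ℚ.≤ p ℚ.+ ε → sq a ℚ.≤ p ℚ.+ ε
  lower p a 0<ε (inj₁ a≡0)  0≤p+ε = ≡.subst (λ a → sq a ℚ.≤ p ℚ.+ _) (≡.sym a≡0) 0≤p+ε
  lower p a 0<ε (inj₂ a²≤p) 0≤p+ε = ℚ.≤-trans a²≤p (p≤p+q p (ℚ.<⇒≤ 0<ε))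

x≤√x*√x : ∀ x → x ≤ √ x * √ x
x≤√x*√x x = ≤+ε⇒≤ {x} {√ x * √ x} λ ε 0<ε →
  let B , 0<B , bound = bounded (√ x)
      -- The rounding error is (a + i)² - a² = (2a + i)i, at most (2B + 1)δ when a ≤ B, i ≤ 1 and i
      -- ≤ δ.
      0<C             = ℚ.+-mono-< (ℚ.+-mono-< 0<B 0<B) (ℚ.positive⁻¹ 1ℚ)
      δ , 0<δ , Cδ≡ε  = scale ε (B ℚ.+ B ℚ.+ 1ℚ) 0<ε 0<C
  in eventually-map₂
       (λ n a≤B ι≤δ → upper (seq x n) (approx√ (seq x n) n) (ι n) B δ 0<δ Cδ≡ε
         (approx√-nonNeg (seq x n) n) (0<ι n) (ι-antitone {0} {n} ℕ.z≤n) ι≤δ a≤B (approx√-upper (seq x n) n))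
       bound (archimedean δ 0<δ)
  where
  open +-*-Solver
  upper : ∀ p a i B δ {ε} → 0ℚ ℚ.< δ → (B ℚ.+ B ℚ.+ 1ℚ) ℚ.* δ ≡ ε →
          0ℚ ℚ.≤ a → 0ℚ ℚ.< i → i ℚ.≤ 1ℚ → i ℚ.≤ δ → ℚ.∣ a ∣ ℚ.≤ B →
          p ℚ.< sq (a ℚ.+ i) → p ℚ.≤ sq a ℚ.+ ε
  upper p a i B δ {ε} 0<δ Cδ≡ε 0≤a 0<i i≤1 i≤δ ∣a∣≤B p<[a+i]² = ℚ.≤-trans (ℚ.<⇒≤ p<[a+i]²)
    (≡.subst₂ ℚ._≤_
      (solve 2 (λ a i → a :* a :+ (a :+ a :+ i) :* i := (a :+ i) :* (a :+ i)) ≡.refl a i)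
      (≡.cong (sq a ℚ.+_) Cδ≡ε)
      (ℚ.+-monoʳ-≤ (sq a) (*-mono-≤ {a ℚ.+ a ℚ.+ i} {B ℚ.+ B ℚ.+ 1ℚ} {i} {δ}
        (ℚ.+-mono-≤ (ℚ.+-mono-≤ 0≤a 0≤a) (ℚ.<⇒≤ 0<i)) (ℚ.<⇒≤ 0<δ)
        (ℚ.+-mono-≤ (ℚ.+-mono-≤ a≤B a≤B) i≤1) i≤δ)))
    where a≤B = ℚ.≤-trans (p≤∣p∣ a) ∣a∣≤B

√x*√x≈x : ∀ {x} → 0ℝ ≤ x → √ x * √ x ≈ x
√x*√x≈x {x} 0≤x = ≤-antisym {√ x * √ x} {x} (√x*√x≤x {x} 0≤x) (x≤√x*√x x)

-- The reals as an abstract Euclidean field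

-- Compares sums formed with `_⊞_` and with `_+_`, which agree only propositionally where the former
-- is opaque.
foldr-cong : ∀ {A : Set} {f g : A → A → A} {e : A} → (∀ x y → f x y ≡ g x y) →
             ∀ {n} (x y : Vector A n) → (∀ i → x i ≡ y i) → Vector.foldr f e x ≡ Vector.foldr g e y
foldr-cong         f≡g {zero}  x y x≡y = ≡.refl
foldr-cong {g = g} f≡g {suc n} x y x≡y =
  ≡.trans (f≡g _ _) (≡.cong₂ g (x≡y zero) (foldr-cong f≡g (tail x) (tail y) (x≡y ∘ suc)))

-- Opaque copies of the operations: if they unfolded, comparing two compound
-- expressions would compare their Cauchy proofs.
infixl 7 _⊠_
infixl 6 _⊞_

opaque
  _⊞_ _⊠_ : ℝ → ℝ → ℝ
  _⊞_ = _+_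
  _⊠_ = _*_

  ⊟_ √ᵒ_ : ℝ → ℝ
  ⊟_ = -_
  √ᵒ_ = √_

  ⊞≡+ : ∀ x y → x ⊞ y ≡ x + y
  ⊞≡+ x y = ≡.refl

  ⊠≡* : ∀ x y → x ⊠ y ≡ x * y
  ⊠≡* x y = ≡.refl

  ⊟≡- : ∀ x → ⊟ x ≡ - x
  ⊟≡- x = ≡.refl

  √ᵒ≡√ : ∀ x → √ᵒ x ≡ √ x
  √ᵒ≡√ x = ≡.refl

  ⊞-⊠-isCommutativeRing : IsCommutativeRing _≈_ _⊞_ _⊠_ ⊟_ 0ℝ (const 1ℚ)
  ⊞-⊠-isCommutativeRing = +-*-isCommutativeRing

⊞⊟≡- : ∀ x y → x ⊞ (⊟ y) ≡ x - y
⊞⊟≡- x y = ≡.trans (⊞≡+ x (⊟ y)) (≡.cong (λ t → x + t) {⊟ y} { - y} (⊟≡- y))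

⊞-⊠-commutativeRing : CommutativeRing 0ℓ 0ℓ
⊞-⊠-commutativeRing = record { isCommutativeRing = ⊞-⊠-isCommutativeRing }

open Algebra.Properties.Semiring.Mult (CommutativeRing.semiring ⊞-⊠-commutativeRing)
  using () renaming (_×_ to _⋆_)

opaque
  unfolding _⊞_

  const-homomorphism : ℚ.+-*-rawRing -Raw-AlmostCommutative⟶ fromCommutativeRing ⊞-⊠-commutativeRing
  const-homomorphism = record
    { ⟦_⟧    = const
    ; +-homo = λ p q → ≈-refl {const (p ℚ.+ q)}
    ; *-homo = λ p q → ≈-refl {const (p ℚ.* q)}
    ; -‿homo = λ p → ≈-refl {const (ℚ.- p)}
    ; 0-homo = ≈-refl {0ℝ}
    ; 1-homo = ≈-refl {const 1ℚ}
    }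

  ⊞-monoˡ-≤ : ∀ z {x y} → x ≤ y → x ⊞ z ≤ y ⊞ z
  ⊞-monoˡ-≤ z {x} {y} = +-monoˡ-≤ z {x} {y}

  √ᵒ-cong : ∀ {x y} → x ≈ y → √ᵒ x ≈ √ᵒ y
  √ᵒ-cong {x} {y} = √-cong {x} {y}

  0≤√ᵒ : ∀ x → 0ℝ ≤ √ᵒ x
  0≤√ᵒ = 0≤√

  √ᵒx⊠√ᵒx≈x : ∀ {x} → 0ℝ ≤ x → √ᵒ x ⊠ √ᵒ x ≈ x
  √ᵒx⊠√ᵒx≈x {x} = √x*√x≈x {x}

  seq-⋆1 : ∀ k n → seq (k ⋆ const 1ℚ) n ≡ frac k 0
  seq-⋆1 zero    n = ≡.refl
  seq-⋆1 (suc k) n = ≡.trans (≡.cong (1ℚ ℚ.+_) (seq-⋆1 k n))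
    (≡.trans (ℚ.+-comm 1ℚ (frac k 0)) (≡.sym (frac-suc k 0)))

  archimedean-⋆ : ∀ x → ∃[ k ] x ≤ k ⋆ const 1ℚ
  archimedean-⋆ x =
    let B , 0<B , bound = bounded x
        -- A positive rational is at most its numerator, the denominator being at least 1.
        k               = ℤ.∣ ℚ.↥ B ∣
    in k , ≤+ε⇒≤ {x} {k ⋆ const 1ℚ} λ ε 0<ε → eventually-map
         (λ n ∣x∣≤B → ℚ.≤-trans (p≤∣p∣ (seq x n)) (ℚ.≤-trans ∣x∣≤B (ℚ.≤-trans (q≤∣↥q∣ B)
           (≡.subst (λ p → frac k 0 ℚ.≤ p ℚ.+ ε) (≡.sym (seq-⋆1 k n)) (p≤p+q (frac k 0) (ℚ.<⇒≤ 0<ε))))))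
         bound

-- Classical order and inverses

module Classical (em : ExcludedMiddle 0ℓ) where

  -- As `_≤_` is a negated `_<_`, failure of `0ℝ < x` is itself `x ≤ 0ℝ`, and antisymmetry applies.
  0≤x⇒0<x⊎0≈x : ∀ {x} → 0ℝ ≤ x → 0ℝ < x ⊎ 0ℝ ≈ x
  0≤x⇒0<x⊎0≈x {x} 0≤x with em {0ℝ < x}
  ... | yes 0<x = inj₁ 0<x
  ... | no  0≮x = inj₂ (≤-antisym {0ℝ} {x} 0≤x 0≮x)

  0≤x*y : ∀ {x y} → 0ℝ ≤ x → 0ℝ ≤ y → 0ℝ ≤ x * y
  0≤x*y {x} {y} 0≤x 0≤y with 0≤x⇒0<x⊎0≈x {x} 0≤x | 0≤x⇒0<x⊎0≈x {y} 0≤y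
  ... | inj₁ 0<x | inj₁ 0<y = <⇒≤ {0ℝ} {x * y} (0<x*y {x} {y} 0<x 0<y)
  ... | inj₂ 0≈x | _        = ≤-reflexive {0ℝ} {x * y} (≈-trans {0ℝ} {0ℝ * y} {x * y}
    (≈-sym {0ℝ * y} {0ℝ} (zeroˡ y)) (*-congʳ {0ℝ} {x} y 0≈x))
  ... | inj₁ _   | inj₂ 0≈y = ≤-reflexive {0ℝ} {x * y} (≈-trans {0ℝ} {x * 0ℝ} {x * y}
    (≈-sym {x * 0ℝ} {0ℝ} (zeroʳ x)) (*-cong {x} {x} {0ℝ} {y} (≈-refl {x}) 0≈y))

  ℝ-inverse : ∀ x → ¬ x ≈ 0ℝ → ∃[ y ] y * x ≈ const 1ℚ
  ℝ-inverse x x≉0 = cases em em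
    where
    cases : Dec (0ℝ < x) → Dec (x < 0ℝ) → ∃[ y ] y * x ≈ const 1ℚ
    cases (yes 0<x) _         = inverse-positive x 0<x
    cases (no  0≮x) (no x≮0)  = contradiction (≤-antisym {x} {0ℝ} 0≮x x≮0) x≉0
    cases (no  _)   (yes x<0) = inverse-negative x x<0

  opaque
    unfolding _⊞_

    0≤x⊠y : ∀ {x y} → 0ℝ ≤ x → 0ℝ ≤ y → 0ℝ ≤ x ⊠ y
    0≤x⊠y {x} {y} = 0≤x*y {x} {y}

    ⊠-inverse : ∀ x → ¬ x ≈ 0ℝ → ∃[ y ] y ⊠ x ≈ const 1ℚ
    ⊠-inverse = ℝ-inverse

  ≤-isDecTotalOrder : IsDecTotalOrder _≈_ _≤_
  ≤-isDecTotalOrder = record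
    { isTotalOrder = record
      { isPartialOrder = record
        { isPreorder = record
          { isEquivalence = Setoid.isEquivalence ≈-setoid
          ; reflexive     = λ {x} {y} → ≤-reflexive {x} {y}
          ; trans         = λ {x} {y} {z} → ≤-trans {x} {y} {z}
          }
        ; antisym = λ {x} {y} → ≤-antisym {x} {y}
        }
      ; total = ≤-total
      }
    ; _≟_  = λ _ _ → em
    ; _≤?_ = λ _ _ → em
    }
    where
    ≤-total : ∀ x y → x ≤ y ⊎ y ≤ x
    ≤-total x y with em {y < x}
    ... | yes y<x = inj₂ (<⇒≤ {y} {x} y<x)
    ... | no  y≮x = inj₁ y≮x

  ℝ-euclideanField : EuclideanField
  ℝ-euclideanField = record
    { commutativeRing = ⊞-⊠-commutativeRing
    ; rational        = const-homomorphism
    ; _≤_             = _≤_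
    ; isDecTotalOrder = ≤-isDecTotalOrder
    ; +-monoˡ-≤       = λ z {x} {y} → ⊞-monoˡ-≤ z {x} {y}
    ; 0≤x*y           = λ {x} {y} → 0≤x⊠y {x} {y}
    ; inverse         = ⊠-inverse
    ; archimedean     = archimedean-⋆
    ; √_              = √ᵒ_
    ; √-cong          = λ {x} {y} → √ᵒ-cong {x} {y}
    ; 0≤√             = 0≤√ᵒ
    ; √x*√x≈x         = λ {x} → √ᵒx⊠√ᵒx≈x {x}
    }

  open Euclidean ℝ-euclideanField using (sqNorm; ∥_∥; _⊖_; ∥⊖∥-congʳ; avoidingColouring)

  -- Two vectors are allowed because the entries of `x ⊖ y` use the opaque operations and those of
  -- `x -ᵥ y` the original ones.
  sqNorm≡sum : ∀ {n} (x y : ℝ^ n) → (∀ i → x i ≡ y i) → sqNorm x ≡ sum (Vector.map (λ t → t * t) y)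
  sqNorm≡sum x y x≡y = foldr-cong ⊞≡+ (λ i → x i ⊠ x i) (Vector.map (λ t → t * t) y)
    (λ i → ≡.trans (⊠≡* (x i) (x i)) (≡.cong (λ t → t * t) {x i} {y i} (x≡y i)))

  ∥∥≡‖‖ : ∀ {n} (x y : ℝ^ n) → (∀ i → x i ≡ y i) → ∥ x ∥ ≡ ‖ y ‖
  ∥∥≡‖‖ x y x≡y = ≡.trans (√ᵒ≡√ (sqNorm x))
    (≡.cong √_ {sqNorm x} {sum (Vector.map (λ t → t * t) y)} (sqNorm≡sum x y x≡y))

  ∥⊖∥≡‖-‖ : ∀ {n} (x y : ℝ^ n) → ∥ x ⊖ y ∥ ≡ ‖ x -ᵥ y ‖
  ∥⊖∥≡‖-‖ x y = ∥∥≡‖‖ (x ⊖ y) (x -ᵥ y) (λ i → ⊞⊟≡- (x i) (y i))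

  ‖-‖-congʳ : ∀ {n} (x y z : ℝ^ n) → (∀ i → x i ≈ y i) → ‖ x -ᵥ z ‖ ≈ ‖ y -ᵥ z ‖
  ‖-‖-congʳ x y z x≈y = ≡.subst₂ _≈_ {∥ x ⊖ z ∥} {‖ x -ᵥ z ‖} {∥ y ⊖ z ∥} {‖ y -ᵥ z ‖}
    (∥⊖∥≡‖-‖ x z) (∥⊖∥≡‖-‖ y z) (∥⊖∥-congʳ {x = x} {y} {z} x≈y)

  ℝ-avoidingColouring : ∀ {m n} (a : Fin m → ℝ^ n) → Fin m → (c : ℝ^ n) {ρ r : ℝ} →
    0ℝ ≤ ρ → (∀ i → ‖ a i -ᵥ c ‖ ≈ ρ) →
    (∀ ρ′ c′ → 0ℝ ≤ ρ′ → (∀ i → ‖ a i -ᵥ c′ ‖ ≈ ρ′) → ρ ≤ ρ′) →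
    0ℝ ≤ r → ¬ ρ ≤ r → ∃[ k ] Σ[ colour ∈ (∀ {D} → ℝ^ D → Fin (suc k)) ]
      (∀ {D} {x y : ℝ^ D} → (∀ i → x i ≈ y i) → colour x ≡ colour y) ×
      (∀ {D} (b : Fin m → ℝ^ D) → (∀ i j → dist (b i) (b j) ≈ dist (a i) (a j)) →
        (∀ i → ‖ b i ‖ ≤ r) → ¬ (∀ i j → colour (b i) ≡ colour (b j)))
  ℝ-avoidingColouring a o c {ρ} {r} 0≤ρ sphere minimal 0≤r ρ≰r =
    let k , colour , colour-cong , avoids = avoidingColouring a o c {ρ} {r} 0≤ρ
          (λ i → ≡.subst (_≈ ρ) {‖ a i -ᵥ c ‖} {∥ a i ⊖ c ∥} (≡.sym (∥⊖∥≡‖-‖ (a i) c)) (sphere i))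
          (λ ρ′ c′ 0≤ρ′ sphere′ → minimal ρ′ c′ 0≤ρ′ λ i →
            ≡.subst (_≈ ρ′) {∥ a i ⊖ c′ ∥} {‖ a i -ᵥ c′ ‖} (∥⊖∥≡‖-‖ (a i) c′) (sphere′ i))
          0≤r ρ≰r
    in k , colour , (λ {D} {x} {y} → colour-cong {D} {x} {y}) , λ b isometric bounded → avoids b
         (λ i j → ≡.subst₂ _≈_ {dist (b i) (b j)} {∥ b i ⊖ b j ∥} {dist (a i) (a j)} {∥ a i ⊖ a j ∥}
           (≡.sym (∥⊖∥≡‖-‖ (b i) (b j))) (≡.sym (∥⊖∥≡‖-‖ (a i) (a j))) (isometric i j))
         (λ i → ≡.subst (_≤ r) {‖ b i ‖} {∥ b i ∥} (≡.sym (∥∥≡‖‖ (b i) (b i) (λ _ → ≡.refl))) (bounded i))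

-- From an enumeration of the point set to the colouring of balls

module _ (em : ExcludedMiddle 0ℓ) {d m} (A : Pred (ℝ^ d) 0ℓ)
         (a : Fin (suc m) → ℝ^ d) (a∈A : ∀ i → a i ∈ A)
         (covered : ∀ x → x ∈ A → ∃[ i ] (∀ j → x j ≈ a i j)) (ρ r : ℝ)
         (0≤ρ : 0ℝ ≤ ρ) (c : ℝ^ d) (on-sphere : ∀ x → x ∈ A → ‖ x -ᵥ c ‖ ≈ ρ)
         (smallest : ∀ ρ′ → OnSphereOfRadius A ρ′ → ρ ≤ ρ′) (0<r : 0ℝ < r) (r<ρ : r < ρ) where
  open Classical em

  -- A point of `A` is only `_≈_`-equal to some `a i`, so the sphere condition reaches it through
  -- congruence of the norm.
  minimal : ∀ ρ′ c′ → 0ℝ ≤ ρ′ → (∀ i → ‖ a i -ᵥ c′ ‖ ≈ ρ′) → ρ ≤ ρ′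
  minimal ρ′ c′ 0≤ρ′ sphere′ = smallest ρ′ (0≤ρ′ , c′ , λ x x∈A → on-sphere′ x (covered x x∈A))
    where
    on-sphere′ : ∀ x → ∃[ i ] (∀ j → x j ≈ a i j) → ‖ x -ᵥ c′ ‖ ≈ ρ′
    on-sphere′ x (i , x≈aᵢ) = ≈-trans {‖ x -ᵥ c′ ‖} {‖ a i -ᵥ c′ ‖} {ρ′}
      (‖-‖-congʳ x (a i) c′ x≈aᵢ) (sphere′ i)

  ballColouring : ∃[ k ] NonZero k × ((D : ℕ) .{{_ : NonZero D}} →
    Σ[ χ ∈ Colouring (Ball D r) k ]
      ((A′ : Pred (ℝ^ D) 0ℓ) → A′ ⊆ Ball D r → Congruent A A′ →
        ¬ Monochromatic χ A′))
  ballColouring =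
    let k , colour , colour-cong , avoids = ℝ-avoidingColouring a zero c {ρ} {r} 0≤ρ
          (λ i → on-sphere (a i) (a∈A i)) minimal (<⇒≤ {0ℝ} {r} 0<r) (λ ρ≤r → ρ≤r r<ρ)
    in suc k , _ , λ D →
      record { to   = λ (x , _) → colour x
             ; cong = λ {x} {y} x≈y → colour-cong {x = proj₁ x} {proj₁ y} x≈y }
      , λ A′ A′⊆Ball (f , isometric) monochromatic →
          let b    = λ i → proj₁ (Bijection.to f (a i , a∈A i))
              b∈A′ = λ i → proj₂ (Bijection.to f (a i , a∈A i))
          in avoids b
               (λ i j → isometric (a i , a∈A i) (a j , a∈A j))
               (λ i → A′⊆Ball (b∈A′ i))
               (λ i j → monochromatic (b i , A′⊆Ball (b∈A′ i)) (b j , A′⊆Ball (b∈A′ j)) (b∈A′ i) (b∈A′ j))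

theorem1p5 :
    ExcludedMiddle 0ℓ →
    (d : ℕ) .{{_ : NonZero d}} (A : Pred (ℝ^ d) 0ℓ) → Finite A → Spherical A →
    (ρ r : ℝ) → IsCircumradius A ρ → 0ℝ < r → r < ρ →
    ∃[ k ] NonZero k × ((D : ℕ) .{{_ : NonZero D}} →
      Σ[ χ ∈ Colouring (Ball D r) k ]
        ((A′ : Pred (ℝ^ D) 0ℓ) → A′ ⊆ Ball D r → Congruent A A′ →
          ¬ Monochromatic χ A′))
-- The empty set lies vacuously on a sphere of radius `0ℝ`, so `ρ ≤ 0ℝ`, against `0ℝ < r` and
-- `r < ρ`.
theorem1p5 em d A ([] , mem) _ ρ r ((_ , c , _) , smallest) 0<r r<ρ =
  contradiction r<ρ (≤-trans {ρ} {0ℝ} {r}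
    (smallest 0ℝ (≤-reflexive {0ℝ} {0ℝ} (≈-refl {0ℝ}) , c , λ x x∈A →
      contradiction (Equivalence.to (mem x) x∈A) λ ()))
    (<⇒≤ {0ℝ} {r} 0<r))
theorem1p5 em d A (x₀ ∷ xs , mem) _ ρ r ((0≤ρ , c , on-sphere) , smallest) 0<r r<ρ =
  ballColouring em A a (λ i → Equivalence.from (mem (a i)) (∈-lookup (ℝ^-setoid d) (x₀ ∷ xs) i))
    (λ x x∈A → let x∈xs = Equivalence.to (mem x) x∈A in Any.index x∈xs , lookup-index x∈xs)
    ρ r 0≤ρ c on-sphere smallest 0<r r<ρ
  where
  a : Fin (suc (List.length xs)) → ℝ^ d
  a = List.lookup (x₀ ∷ xs)
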